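{- Let $\mathbf{K}$ be an associative, not necessarily commutative, ring with division by integers and let $n\ge1$. For $n\times n$ matrices $A$ over $\mathbf{K}$: (a) $edet(A)$ is a polyadditive function of the rows and of the columns of $A$ (additive in each row when the other rows are fixed, and additive in each column when the other columns are fixed); (b) $edet(A)$ is an antisymmetric function of the rows and of the columns of $A$ (interchanging two distinct rows, or two distinct columns, changes $edet(A)$ to $-edet(A)$); (c) $edet(A)=0$ if $A$ contains a zero row or a zero column; (d) $edet(A)=0$ if $A$ contains two equal rows or two equal columns; (e) $edet(A)=edet(A^T)$. Moreover, the Laplace expansion formulas and the formula $edet(AB)=edet(A)\,edet(B)$ are not valid in general: they do not hold for all such rings $\mathbf{K}$, all $n$, and all $n\times n$ matrices.
   Context: A ring is "with division by integers" if for every nonzero integer $m$ the map $x\mapsto mx$ is bijective on the ring; $\frac1m x$ denotes the inverse image of $x$. Rings are not assumed to have a unit. For $A=(a_{ij})$ an $n\times n$ matrix over $\mathbf{K}$, define $$edet(A)=\frac{ -1}{n!}\Big\{\sum_{l\in L_{n-1}^{(e)}}su(l)^n-\sum_{l\in L_{n-1}^{(o)}}su(l)^n+\sum_{l\in L_n^{(o)}}su(l)^n-\sum_{l\in L_n^{(e)}}su(l)^n\Big\}.$$ Here $S_n^{(e)}$, $S_n^{(o)}$ are the sets of even and odd permutations of $\{1,\dots,n\}$. For a permutation $\sigma$ and $1\le i_1<\dots<i_k\le n$, the sequence $l=(a_{i_1\sigma(i_1)},\dots,a_{i_k\sigma(i_k)})$ is a subdiagonal of length $k$ of the diagonal $(a_{1\sigma(1)},\dots,a_{n\sigma(n)})$;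 subdiagonals are identified by their positions $\{(i_1,\sigma(i_1)),\dots,(i_k,\sigma(i_k))\}$ in the matrix (not merely by the values of the entries). $L_k^{(e)}$ (respectively $L_k^{(o)}$) is the set of all subdiagonals of length $k$ of diagonals with $\sigma\in S_n^{(e)}$ (respectively $\sigma\in S_n^{(o)}$), and $su(l)=\sum_{s=1}^k a_{i_s\sigma(i_s)}$. For $n=1$, $L_0^{(e)}$ consists of the empty subdiagonal, with $su=0$, and $L_0^{(o)}=\emptyset$. The Laplace expansion formulas are $edet(A)=\sum_{j=1}^n(-1)^{i+j}a_{ij}\,edet(A_{ij})$ (row $i$) and $edet(A)=\sum_{i=1}^n(-1)^{i+j}a_{ij}\,edet(A_{ij})$ (column $j$), where $n\ge2$ and $A_{ij}$ is $A$ with row $i$ and column $j$ deleted. -}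

module Defs where

open import Algebra.Bundles using (AbelianGroup; RingWithoutOne)
import Algebra.Definitions.RawMonoid as RawMonoid
open import Data.Fin.Base using (Fin; zero; suc; toℕ; punchIn)
import Data.Fin.Properties as Fin
open import Data.Fin.Permutation as Perm
  using (Permutation′; _⟨$⟩ʳ_; _≈_; insert; remove; insert-remove)
open import Data.Integer.Base as ℤ using (ℤ; +_; -[1+_]; -1ℤ)
open import Data.List.Base as List
  using (List; []; _∷_; _++_; allFin; cartesianProduct; cartesianProductWith; deduplicate; filter; length)
open import Data.List.Membership.Propositional using (_∈_)
open import Data.List.Membership.Propositional.Properties
  using (∈-allFin; ∈-cartesianProductWith⁺)
open import Data.List.Relation.Unary.Any using (here)
open import Data.Nat.Base as ℕ using (ℕ; zero; suc; _!; parity)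
open import Data.Nat.Properties using (_!≢0)
open import Data.Parity using (Parity; 0ℙ; 1ℙ; _≟_)
open import Data.Product.Base using (_×_; _,_; ∃; proj₁; proj₂)
open import Data.Product.Properties using (≡-dec)
open import Data.Vec.Base as Vec using (Vec; []; _∷_)
import Data.Vec.Properties as Vec
open import Data.Vec.Functional as Vector using (Vector; removeAt; updateAt)
open import Function.Base using (const)
open import Function.Definitions using (Bijective)
open import Level using (Level; _⊔_)
open import Relation.Binary.Definitions using (DecidableEquality)
open import Relation.Binary.PropositionalEquality.Core using (_≡_; refl; cong; trans)
open import Relation.Nullary.Decidable.Core using (_×-dec_)

private
  variable
    a : Level
    A : Set a
    m n k : ℕ

permutations : ∀ n → List (Permutation′ n)
permutations zero    = Perm.id ∷ []
permutations (suc n) =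
  cartesianProductWith (insert zero) (allFin (suc n)) (permutations n)

permutations-complete : (σ : Permutation′ n) →
                        ∃ λ τ → τ ∈ permutations n × τ ≈ σ
permutations-complete {zero}  σ = Perm.id , here refl , λ ()
permutations-complete {suc n} σ
  with τ , τ∈ , τ≈ ← permutations-complete (remove zero σ)
  = insert zero (σ ⟨$⟩ʳ zero) τ
  , ∈-cartesianProductWith⁺ (insert zero) (∈-allFin _) τ∈
  , λ i → trans (insert-cong i) (insert-remove zero σ i)
  where
  insert-cong : insert zero (σ ⟨$⟩ʳ zero) τ ≈
                insert zero (σ ⟨$⟩ʳ zero) (remove zero σ)
  insert-cong zero    = refl
  insert-cong (suc i) = cong (punchIn (σ ⟨$⟩ʳ zero)) (τ≈ i)

inversions : Permutation′ n → List (Fin n × Fin n)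
inversions {n} σ =
  filter (λ (i , j) → (i Fin.<? j) ×-dec ((σ ⟨$⟩ʳ j) Fin.<? (σ ⟨$⟩ʳ i)))
         (cartesianProduct (allFin n) (allFin n))

-- 0ℙ for even permutations, 1ℙ for odd ones.

sgn : Permutation′ n → Parity
sgn σ = parity (length (inversions σ))

permutationsOf : Parity → ∀ n → List (Permutation′ n)
permutationsOf π n = filter (λ σ → sgn σ ≟ π) (permutations n)

-- Sublists of length k, in the order of the list: applied to allFin n these
-- are the sequences i₁ < … < iₖ.

choose : ∀ k → List A → List (Vec A k)
choose zero    xs       = [] ∷ []
choose (suc k) []       = []
choose (suc k) (x ∷ xs) = List.map (x ∷_) (choose k xs) ++ choose (suc k) xs

-- Subdiagonals are represented by their positions, listed by increasing row,
-- so that equality of position sets is equality of vectors.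

Subdiagonal : ℕ → ℕ → Set
Subdiagonal n k = Vec (Fin n × Fin n) k

_≟ˢ_ : DecidableEquality (Subdiagonal n k)
_≟ˢ_ = Vec.≡-dec (≡-dec Fin._≟_ Fin._≟_)

subdiagonal : Permutation′ n → Vec (Fin n) k → Subdiagonal n k
subdiagonal σ = Vec.map (λ i → i , σ ⟨$⟩ʳ i)

-- The set L_k^(e) for π = 0ℙ and L_k^(o) for π = 1ℙ: a subdiagonal shared by
-- several diagonals is listed once.

L : Parity → ∀ n k → List (Subdiagonal n k)
L π n k = deduplicate _≟ˢ_
  (cartesianProductWith subdiagonal (permutationsOf π n) (choose k (allFin n)))

module _ {c ℓ} (K : RingWithoutOne c ℓ) where

  open RingWithoutOne K renaming (_≈_ to _≈ᴷ_)
  open RawMonoid (AbelianGroup.rawMonoid +-abelianGroup) using (sum) renaming (_×_ to _×ᴷ_)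

  infixr 8 _·_
  _·_ : ℤ → Carrier → Carrier
  (+ m)    · x = m ×ᴷ x
  -[1+ m ] · x = - (suc m ×ᴷ x)

  DivisionByIntegers : Set (c ⊔ ℓ)
  DivisionByIntegers = ∀ m .{{_ : ℤ.NonZero m}} → Bijective _≈ᴷ_ _≈ᴷ_ (m ·_)

  Matrix : ℕ → Set c
  Matrix n = Vector (Vector Carrier n) n

  -- The exponent is suc m, as there is no unit to serve as zeroth power.

  _^1+_ : Carrier → ℕ → Carrier
  x ^1+ zero  = x
  x ^1+ suc m = x * (x ^1+ m)

  su : Matrix n → Subdiagonal n k → Carrier
  su A l = Vec.foldr′ _+_ 0# (Vec.map (λ (i , j) → A i j) l)

  ∑ : List A → (A → Carrier) → Carrier
  ∑ xs f = List.foldr (λ x s → f x + s) 0# xs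

  infixl 7 _⊗_
  _⊗_ : Matrix n → Matrix n → Matrix n
  (A ⊗ B) i j = sum (λ k → A i k * B k j)

  setRow : Matrix n → Fin n → Vector Carrier n → Matrix n
  setRow A i u = updateAt A i (const u)

  setColumn : Matrix n → Fin n → Vector Carrier n → Matrix n
  setColumn A j u i = updateAt (A i) j (const (u i))

  swapRows : Fin n → Fin n → Matrix n → Matrix n
  swapRows i j A k = A (Perm.transpose i j ⟨$⟩ʳ k)

  swapColumns : Fin n → Fin n → Matrix n → Matrix n
  swapColumns i j A k l = A k (Perm.transpose i j ⟨$⟩ʳ l)

  minor : Matrix (suc n) → Fin (suc n) → Fin (suc n) → Matrix n
  minor A i j = Vector.map (λ row → removeAt row j) (removeAt A i)

  -- (-1)^(i+j) x. Counting indices from 0 rather than 1 does not affect it.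

  cofactorSign : Fin m → Fin n → Carrier → Carrier
  cofactorSign i j x = (-1ℤ ℤ.^ (toℕ i ℕ.+ toℕ j)) · x

  module _ (div : DivisionByIntegers) where

    1/_·_ : ∀ m .{{_ : ℤ.NonZero m}} → Carrier → Carrier
    1/ m · x = proj₁ (proj₂ (div m) x)

    edet : Matrix (suc n) → Carrier
    edet {n} A = - (1/ + (suc n !) · braces)
      where
      instance _ = suc n !≢0

      S : Parity → ℕ → Carrier
      S π k = ∑ (L π (suc n) k) (λ l → su A l ^1+ n)

      braces : Carrier
      braces = S 0ℙ n - S 1ℙ n + S 1ℙ (suc n) - S 0ℙ (suc n)

    RowExpansion : Matrix (suc (suc n)) → Fin (suc (suc n)) → Set ℓ
    RowExpansion A i =
      edet A ≈ᴷ sum (λ j → cofactorSign i j (A i j * edet (minor A i j)))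

    ColumnExpansion : Matrix (suc (suc n)) → Fin (suc (suc n)) → Set ℓ
    ColumnExpansion A j =
      edet A ≈ᴷ sum (λ i → cofactorSign i j (A i j * edet (minor A i j)))

{-# OPTIONS --safe #-}

-- For x = (a_{1σ1}, …, a_{nσn}) put s = x₁ + … + xₙ and
-- G(x) = sⁿ - Σₖ (s - xₖ)ⁿ. A subdiagonal of length n or n - 1 determines its
-- diagonal, hence n! edet(A) = Σ_σ sgn(σ) G(x). Reindexing this sum by σ ↦ σ⁻¹
-- and by σ ↦ σ ∘ (i j) gives (e) and (b), and (b) implies (d).
--
-- G consists of the terms with at most one omitted index in the polarization
-- Δ_{x₁} … Δ_{xₙ} (yⁿ) at y = 0. A term omitting two indices i and j is unchanged
-- under σ ↦ σ ∘ (i j), so it cancels in the signed sum, and G may be replaced by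
-- the full polarization. The latter is additive in each xᵢ because yⁿ has degree
-- n, that is, its (n + 1)-fold differences vanish. This gives (a), hence (c).
--
-- The counterexamples are diagonal 2 × 2 matrices over the rational upper
-- triangular 2 × 2 matrices, where edet (diag (x , y)) = (xy + yx) / 2.

module Submission where

open import Algebra.Bundles using (AbelianGroup; RingWithoutOne)
import Algebra.Definitions.RawMonoid as RawMonoid
open import Data.Bool.Base using (Bool; true; false; if_then_else_)
open import Data.Fin.Base using (Fin; zero; suc)
open import Data.Fin.Permutation as Perm
  using (Permutation′; _⟨$⟩ʳ_; _⟨$⟩ˡ_; _∘ₚ_; flip; inverseˡ; inverseʳ; insert; insert-punchIn)
import Data.Fin.Properties as Fin
open import Data.Integer.Base as ℤ using (ℤ; +_; -[1+_])
import Data.Integer.Properties as ℤ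
open import Data.List.Base as List
  using (List; []; _∷_; _++_; length; allFin; filter; map; cartesianProduct;
         cartesianProductWith; deduplicate; tabulate)
open import Data.List.Membership.Propositional using (_∈_; lose)
open import Data.List.Membership.Propositional.Properties
  using (∈-map⁻; ∈-++⁻; ∈-cartesianProductWith⁻; ∈-allFin)
import Data.List.Properties as List
open import Data.List.Relation.Unary.All as All using (All; []; _∷_)
open import Data.List.Relation.Unary.AllPairs using (AllPairs; []; _∷_)
open import Data.List.Relation.Unary.Any as Any using (Any; here; there; _─_)
open import Data.List.Relation.Unary.Unique.Propositional using (Unique)
open import Data.List.Relation.Unary.Unique.Propositional.Properties as Unique using (allFin⁺)
import Data.List.Relation.Unary.Unique.Setoid.Properties as Uniqueₛ
open import Data.Nat.Base as ℕ using (ℕ; zero; suc; s≤s; _!; parity)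
import Data.Nat.Properties as ℕ
open import Data.Parity.Base as ℙ using (Parity; 0ℙ; 1ℙ)
import Data.Parity.Properties as ℙ
open import Data.Product.Base using (_×_; _,_; proj₁; proj₂)
import Data.Rational.Unnormalised.Base as ℚ
import Data.Rational.Unnormalised.Properties as ℚₚ
open import Data.Rational.Unnormalised.Solver using (module +-*-Solver)
open import Data.Sum.Base using (_⊎_; inj₁; inj₂)
open import Data.Vec.Base as Vec using (Vec; []; _∷_; lookup)
open import Data.Vec.Functional as Vector using (Vector; transpose; updateAt; head; tail)
import Data.Vec.Functional.Properties as Vector
open import Data.Vec.Membership.Propositional using () renaming (_∈_ to _∈ᵥ_)
open import Data.Vec.Relation.Unary.Any using (here; there)
import Data.Vec.Properties as Vec
open import Function.Base using (_∘_; id; const)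
open import Function.Bundles using (Injection)
open import Function.Properties.Inverse using (↔⇒↣)
open import Level using (Level)
open import Relation.Binary.Bundles using (Setoid)
open import Relation.Binary.Core using (Rel)
open import Relation.Binary.Definitions using (DecidableEquality; tri<; tri≈; tri>)
open import Relation.Binary.PropositionalEquality as ≡
  using (_≡_; _≢_; cong; cong₂; subst; module ≡-Reasoning)
open import Relation.Nullary.Decidable
  using (Dec; yes; no; does; dec-true; dec-false; _×-dec_; ¬?)
open import Relation.Nullary.Negation.Core using (¬_; contradiction)
open import Algebra.Properties.CommutativeMonoid.Sum ℙ.+-0-commutativeMonoid using () renaming
  ( sum to sumℙ; sum-cong-≗ to sumℙ-cong; sum-permute to sumℙ-permute
  ; ∑-distrib-+ to sumℙ-+; ∑-comm to sumℙ-comm; sum-replicate-zero to sumℙ-replicate-0ℙ)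
open import Defs

-- The full polarization of yⁿ is the sum of the products of x₁, ..., xₙ in all n! orders. Thus
-- `edet` averages the usual signed sum over all orders of multiplication, which explains both the
-- denominator n! and the value (xy + yx) / 2. Division by integers enters in two ways: n! is
-- cancelled from identities between multiples of `edet`, and the absence of 2-torsion turns an
-- element equal to its own negative into zero. The combinatorial obstacles lie in the
-- representation. `L` is a deduplicated list, so deduplication must be shown to remove nothing.
-- Permutations can only be compared pointwise, so a reindexing is justified by counting the image
-- of the enumeration under an injective map. Signs are inversion counts modulo two, and the sign
-- rules become identities between double sums over the field with two elements.

private
  variable
    a b c : Level
    A B C X Y Z : Set a
    n k : ℕ

-- Signs of permutations

-- `Parity` serves as the field with two elements: conjunction becomes multiplication and counting
-- modulo two becomes addition.
bit : Bool → Parity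
bit false = 0ℙ
bit true  = 1ℙ

lt : Fin n → Fin n → Parity
lt i j = bit (does (i Fin.<? j))

lt-irrefl : (i : Fin n) → lt i i ≡ 0ℙ
lt-irrefl i = cong bit (dec-false (i Fin.<? i) (Fin.<-irrefl ≡.refl))

lt-flip : {i j : Fin n} → i ≢ j → lt i j ≡ 1ℙ ℙ.+ lt j i
lt-flip {i = i} {j} i≢j with Fin.<-cmp i j
... | tri< i<j _ j≮i = ≡.trans (cong bit (dec-true (i Fin.<? j) i<j))
  (≡.sym (cong (λ b → 1ℙ ℙ.+ bit b) (dec-false (j Fin.<? i) j≮i)))
... | tri≈ _ i≡j _ = contradiction i≡j i≢j
... | tri> i≮j _ j<i = ≡.trans (cong bit (dec-false (i Fin.<? j) i≮j))
  (≡.sym (cong (λ b → 1ℙ ℙ.+ bit b) (dec-true (j Fin.<? i) j<i)))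

perm-injective : (σ : Permutation′ n) {i j : Fin n} → σ ⟨$⟩ʳ i ≡ σ ⟨$⟩ʳ j → i ≡ j
perm-injective σ = Injection.injective (↔⇒↣ σ)

sumℙ₂ : (Fin n → Fin n → Parity) → Parity
sumℙ₂ g = sumℙ (λ i → sumℙ (g i))

sumℙ₂-cong : {f g : Fin n → Fin n → Parity} → (∀ i j → f i j ≡ g i j) → sumℙ₂ f ≡ sumℙ₂ g
sumℙ₂-cong f≗g = sumℙ-cong (λ i → sumℙ-cong (f≗g i))

sumℙ₂-+ : (f g : Fin n → Fin n → Parity) → sumℙ₂ (λ i j → f i j ℙ.+ g i j) ≡ sumℙ₂ f ℙ.+ sumℙ₂ g
sumℙ₂-+ f g = ≡.trans (sumℙ-cong (λ i → sumℙ-+ (f i) (g i))) (sumℙ-+ (sumℙ ∘ f) (sumℙ ∘ g))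

sumℙ₂-permute : (ρ : Permutation′ n) (g : Fin n → Fin n → Parity) →
               sumℙ₂ g ≡ sumℙ₂ (λ i j → g (ρ ⟨$⟩ʳ i) (ρ ⟨$⟩ʳ j))
sumℙ₂-permute ρ g = ≡.trans (sumℙ-permute _ ρ) (sumℙ-cong (λ i → sumℙ-permute (g (ρ ⟨$⟩ʳ i)) ρ))

-- Off-diagonal terms cancel in pairs.
sumℙ₂-symmetric : (g : Fin n → Fin n → Parity) → (∀ i j → g i j ≡ g j i) →
                 sumℙ₂ g ≡ sumℙ (λ i → g i i)
sumℙ₂-symmetric {zero}  g g-sym = ≡.refl
sumℙ₂-symmetric {suc n} g g-sym = begin
  (g zero zero ℙ.+ row) ℙ.+ sumℙ (λ i → g (suc i) zero ℙ.+ sumℙ (λ j → g (suc i) (suc j)))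
    ≡⟨ cong (λ s → (g zero zero ℙ.+ row) ℙ.+ s) (sumℙ-+ (λ i → g (suc i) zero) _) ⟩
  (g zero zero ℙ.+ row) ℙ.+ (sumℙ (λ i → g (suc i) zero) ℙ.+ sumℙ₂ (λ i j → g (suc i) (suc j)))
    ≡⟨ cong₂ (λ s t → (g zero zero ℙ.+ row) ℙ.+ (s ℙ.+ t))
         (sumℙ-cong (λ i → g-sym (suc i) zero))
         (sumℙ₂-symmetric (λ i j → g (suc i) (suc j)) (λ i j → g-sym (suc i) (suc j))) ⟩
  (g zero zero ℙ.+ row) ℙ.+ (row ℙ.+ diagonal)
    ≡⟨ ℙ.+-assoc (g zero zero) row _ ⟩
  g zero zero ℙ.+ (row ℙ.+ (row ℙ.+ diagonal))
    ≡⟨ cong (g zero zero ℙ.+_) (ℙ.+-assoc row row diagonal) ⟨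
  g zero zero ℙ.+ ((row ℙ.+ row) ℙ.+ diagonal)
    ≡⟨ cong (λ s → g zero zero ℙ.+ (s ℙ.+ diagonal)) (ℙ.p+p≡0ℙ row) ⟩
  g zero zero ℙ.+ diagonal ∎
  where
  open ≡-Reasoning
  row diagonal : Parity
  row      = sumℙ (λ j → g zero (suc j))
  diagonal = sumℙ (λ i → g (suc i) (suc i))

sumℙ-zero : (g : Fin n → Parity) → (∀ i → g i ≡ 0ℙ) → sumℙ g ≡ 0ℙ
sumℙ-zero {n} g g≡0 = ≡.trans (sumℙ-cong g≡0) (sumℙ-replicate-0ℙ n)

sumℙ-indicator : (i : Fin n) (g : Fin n → Parity) → g i ≡ 1ℙ → (∀ j → j ≢ i → g j ≡ 0ℙ) →
                sumℙ g ≡ 1ℙ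
sumℙ-indicator zero    g gi g0 =
  cong₂ ℙ._+_ gi (sumℙ-zero (g ∘ suc) (λ j → g0 (suc j) (λ ())))
sumℙ-indicator (suc i) g gi g0 =
  cong₂ ℙ._+_ (g0 zero (λ ()))
    (sumℙ-indicator i (g ∘ suc) gi (λ j j≢i → g0 (suc j) (j≢i ∘ Fin.suc-injective)))

parity-filter-++ : {P : A → Set b} (P? : ∀ x → Dec (P x)) (xs ys : List A) →
  parity (length (filter P? (xs ++ ys))) ≡
  parity (length (filter P? xs)) ℙ.+ parity (length (filter P? ys))
parity-filter-++ P? xs ys = begin
  parity (length (filter P? (xs ++ ys)))
    ≡⟨ cong (parity ∘ length) (List.filter-++ P? xs ys) ⟩
  parity (length (filter P? xs ++ filter P? ys))
    ≡⟨ cong parity (List.length-++ (filter P? xs)) ⟩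
  parity (length (filter P? xs) ℕ.+ length (filter P? ys))
    ≡⟨ ℙ.+-homo-+ (length (filter P? xs)) _ ⟩
  _ ∎
  where open ≡-Reasoning

parity-filter-∷ : {P : A → Set b} (P? : ∀ x → Dec (P x)) (x : A) (xs : List A) →
  parity (length (filter P? (x ∷ xs))) ≡ bit (does (P? x)) ℙ.+ parity (length (filter P? xs))
parity-filter-∷ P? x xs with does (P? x)
... | false = ≡.refl
... | true  = ℙ.+-homo-+ 1 (length (filter P? xs))

parity-filter-tabulate : {P : A → Set b} (P? : ∀ x → Dec (P x)) (f : Fin n → A) →
  parity (length (filter P? (tabulate f))) ≡ sumℙ (λ i → bit (does (P? (f i))))
parity-filter-tabulate {n = zero}  P? f = ≡.refl
parity-filter-tabulate {n = suc n} P? f =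
  ≡.trans (parity-filter-∷ P? (f zero) (tabulate (f ∘ suc)))
        (cong (bit (does (P? (f zero))) ℙ.+_) (parity-filter-tabulate P? (f ∘ suc)))

parity-filter-product : ∀ {m} {P : A × B → Set c} (P? : ∀ x → Dec (P x))
  (f : Fin m → A) (g : Fin n → B) →
  parity (length (filter P? (cartesianProduct (tabulate f) (tabulate g)))) ≡
  sumℙ (λ i → sumℙ (λ j → bit (does (P? (f i , g j)))))
parity-filter-product {m = zero}  P? f g = ≡.refl
parity-filter-product {m = suc m} P? f g = begin
  parity (length (filter P? (map (f zero ,_) (tabulate g) ++ rest)))
    ≡⟨ parity-filter-++ P? (map (f zero ,_) (tabulate g)) rest ⟩
  parity (length (filter P? (map (f zero ,_) (tabulate g)))) ℙ.+ parity (length (filter P? rest))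
    ≡⟨ cong₂ ℙ._+_
         (≡.trans (cong (parity ∘ length ∘ filter P?) (List.map-tabulate g (f zero ,_)))
                (parity-filter-tabulate P? (λ j → f zero , g j)))
         (parity-filter-product P? (f ∘ suc) g) ⟩
  _ ∎
  where
  open ≡-Reasoning
  rest = cartesianProduct (tabulate (f ∘ suc)) (tabulate g)

bit-∧ : {P Q : Set} (P? : Dec P) (Q? : Dec Q) →
        bit (does (P? ×-dec Q?)) ≡ bit (does P?) ℙ.* bit (does Q?)
bit-∧ P? Q? with does P? | does Q?
... | false | _     = ≡.refl
... | true  | false = ≡.refl
... | true  | true  = ≡.refl

sgn-sum : (σ : Permutation′ n) →
          sgn σ ≡ sumℙ₂ (λ i j → lt i j ℙ.* lt (σ ⟨$⟩ʳ j) (σ ⟨$⟩ʳ i))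
sgn-sum σ = ≡.trans
  (parity-filter-product (λ (i , j) → (i Fin.<? j) ×-dec ((σ ⟨$⟩ʳ j) Fin.<? (σ ⟨$⟩ʳ i))) id id)
  (sumℙ₂-cong (λ i j → bit-∧ (i Fin.<? j) ((σ ⟨$⟩ʳ j) Fin.<? (σ ⟨$⟩ʳ i))))

sgn-cong : {σ τ : Permutation′ n} → σ Perm.≈ τ → sgn σ ≡ sgn τ
sgn-cong {σ = σ} {τ} σ≈τ = begin
  sgn σ  ≡⟨ sgn-sum σ ⟩
  _      ≡⟨ sumℙ₂-cong (λ i j → cong₂ (λ k l → lt i j ℙ.* lt k l) (σ≈τ j) (σ≈τ i)) ⟩
  _      ≡⟨ sgn-sum τ ⟨
  sgn τ  ∎
  where open ≡-Reasoning

-- A pair (i , j) is an inversion of σ⁻¹ exactly when (σ⁻¹ j , σ⁻¹ i) is one of σ. In the double sum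
-- this is reindexing by σ followed by an exchange of the two summations.
sgn-flip : (σ : Permutation′ n) → sgn (flip σ) ≡ sgn σ
sgn-flip σ = begin
  sgn (flip σ)
    ≡⟨ sgn-sum (flip σ) ⟩
  sumℙ₂ (λ i j → lt i j ℙ.* lt (σ ⟨$⟩ˡ j) (σ ⟨$⟩ˡ i))
    ≡⟨ sumℙ₂-permute σ _ ⟩
  sumℙ₂ (λ i j → lt (σ ⟨$⟩ʳ i) (σ ⟨$⟩ʳ j) ℙ.* lt (σ ⟨$⟩ˡ (σ ⟨$⟩ʳ j)) (σ ⟨$⟩ˡ (σ ⟨$⟩ʳ i)))
    ≡⟨ sumℙ₂-cong (λ i j → ≡.trans
         (cong₂ (λ k l → lt (σ ⟨$⟩ʳ i) (σ ⟨$⟩ʳ j) ℙ.* lt k l) (inverseˡ σ) (inverseˡ σ))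
         (ℙ.*-comm (lt (σ ⟨$⟩ʳ i) (σ ⟨$⟩ʳ j)) _)) ⟩
  sumℙ₂ (λ i j → lt j i ℙ.* lt (σ ⟨$⟩ʳ i) (σ ⟨$⟩ʳ j))
    ≡⟨ sumℙ-comm (λ i j → lt j i ℙ.* lt (σ ⟨$⟩ʳ i) (σ ⟨$⟩ʳ j)) ⟩
  sumℙ₂ (λ i j → lt i j ℙ.* lt (σ ⟨$⟩ʳ j) (σ ⟨$⟩ʳ i))
    ≡⟨ sgn-sum σ ⟨
  sgn σ ∎
  where open ≡-Reasoning

module _ (ρ : Permutation′ n) (ρ-involutive : ∀ i → ρ ⟨$⟩ʳ (ρ ⟨$⟩ʳ i) ≡ i) where

  private
    r : Fin n → Fin n
    r = ρ ⟨$⟩ʳ_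

  open ≡-Reasoning

  -- The inversion (i , j) is paired with (ρ j , ρ i); the fixed points of this
  -- pairing are the inversions (i , ρ i).
  sgn-involution : sgn ρ ≡ sumℙ (λ i → lt i (r i))
  sgn-involution = begin
    sgn ρ
      ≡⟨ sgn-sum ρ ⟩
    sumℙ₂ (λ i j → lt i j ℙ.* lt (r j) (r i))
      ≡⟨ sumℙ-cong (λ i → sumℙ-permute (λ j → lt i j ℙ.* lt (r j) (r i)) ρ) ⟩
    sumℙ₂ (λ i j → lt i (r j) ℙ.* lt (r (r j)) (r i))
      ≡⟨ sumℙ₂-cong (λ i j → cong (λ k → lt i (r j) ℙ.* lt k (r i)) (ρ-involutive j)) ⟩
    sumℙ₂ (λ i j → lt i (r j) ℙ.* lt j (r i))
      ≡⟨ sumℙ₂-symmetric _ (λ i j → ℙ.*-comm (lt i (r j)) _) ⟩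
    sumℙ (λ i → lt i (r i) ℙ.* lt i (r i))
      ≡⟨ sumℙ-cong (λ i → ℙ.*-idem (lt i (r i))) ⟩
    sumℙ (λ i → lt i (r i)) ∎

  -- With d i j = [ρ i < ρ j] + [i < j], both sgn (ρ ∘ₚ σ) + sgn σ and sgn ρ are
  -- sums of d against functions whose difference is symmetric off the diagonal.
  sgn-∘ₚ-involution : (σ : Permutation′ n) → sgn (ρ ∘ₚ σ) ≡ sgn ρ ℙ.+ sgn σ
  sgn-∘ₚ-involution σ = begin
    sgn (ρ ∘ₚ σ)
      ≡⟨ sgn-sum (ρ ∘ₚ σ) ⟩
    sumℙ₂ (λ i j → lt i j ℙ.* lt (s (r j)) (s (r i)))
      ≡⟨ sumℙ₂-permute ρ _ ⟩
    sumℙ₂ (λ i j → lt (r i) (r j) ℙ.* lt (s (r (r j))) (s (r (r i))))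
      ≡⟨ sumℙ₂-cong (λ i j → cong₂ (λ k l → lt (r i) (r j) ℙ.* lt (s k) (s l))
           (ρ-involutive j) (ρ-involutive i)) ⟩
    sumℙ₂ (λ i j → lt (r i) (r j) ℙ.* lt (s j) (s i))
      ≡⟨ sumℙ₂-cong split ⟩
    sumℙ₂ (λ i j → ((lt i j ℙ.* lt (r j) (r i)) ℙ.+ (lt i j ℙ.* lt (s j) (s i))) ℙ.+ e i j)
      ≡⟨ sumℙ₂-+ _ e ⟩
    sumℙ₂ (λ i j → (lt i j ℙ.* lt (r j) (r i)) ℙ.+ (lt i j ℙ.* lt (s j) (s i))) ℙ.+ sumℙ₂ e
      ≡⟨ cong₂ ℙ._+_ (sumℙ₂-+ (λ i j → lt i j ℙ.* lt (r j) (r i)) _)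
           (≡.trans (sumℙ₂-symmetric e e-symmetric) (sumℙ-zero _ e-diagonal)) ⟩
    (sumℙ₂ (λ i j → lt i j ℙ.* lt (r j) (r i)) ℙ.+ sumℙ₂ (λ i j → lt i j ℙ.* lt (s j) (s i))) ℙ.+ 0ℙ
      ≡⟨ ℙ.+-identityʳ _ ⟩
    sumℙ₂ (λ i j → lt i j ℙ.* lt (r j) (r i)) ℙ.+ sumℙ₂ (λ i j → lt i j ℙ.* lt (s j) (s i))
      ≡⟨ cong₂ ℙ._+_ (sgn-sum ρ) (sgn-sum σ) ⟨
    sgn ρ ℙ.+ sgn σ ∎
    where
    s : Fin n → Fin n
    s = σ ⟨$⟩ʳ_

    e : Fin n → Fin n → Parity
    e i j = (lt (r i) (r j) ℙ.+ lt i j) ℙ.* (lt (s j) (s i) ℙ.+ lt i j)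

    e-diagonal : ∀ i → e i i ≡ 0ℙ
    e-diagonal i rewrite lt-irrefl i | lt-irrefl (r i) = ≡.refl

    -- Exchanging `i` and `j` complements every bit, and the two complements inside each factor
    -- cancel modulo two.
    flipped : ∀ p q t → (p ℙ.+ q) ℙ.* (t ℙ.+ q) ≡
              ((1ℙ ℙ.+ p) ℙ.+ (1ℙ ℙ.+ q)) ℙ.* ((1ℙ ℙ.+ t) ℙ.+ (1ℙ ℙ.+ q))
    flipped 0ℙ 0ℙ _  = ≡.refl
    flipped 0ℙ 1ℙ 0ℙ = ≡.refl
    flipped 0ℙ 1ℙ 1ℙ = ≡.refl
    flipped 1ℙ 0ℙ 0ℙ = ≡.refl
    flipped 1ℙ 0ℙ 1ℙ = ≡.refl
    flipped 1ℙ 1ℙ _  = ≡.refl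

    e-symmetric : ∀ i j → e i j ≡ e j i
    e-symmetric i j with i Fin.≟ j
    ... | yes ≡.refl = ≡.refl
    ... | no  i≢j
      rewrite lt-flip {i = j} {i} (i≢j ∘ ≡.sym)
            | lt-flip {i = r j} {r i} (i≢j ∘ ≡.sym ∘ perm-injective ρ)
            | lt-flip {i = s i} {s j} (i≢j ∘ perm-injective σ)
      = flipped (lt (r i) (r j)) (lt i j) (lt (s j) (s i))

    -- Multiplying out the right side with `q` idempotent leaves only `p ℙ.* t`; here `1ℙ ℙ.+ p`
    -- stands for `lt (r j) (r i)`.
    expand : ∀ p q t → p ℙ.* t ≡ ((q ℙ.* (1ℙ ℙ.+ p)) ℙ.+ (q ℙ.* t)) ℙ.+ ((p ℙ.+ q) ℙ.* (t ℙ.+ q))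
    expand 0ℙ 0ℙ _  = ≡.refl
    expand 0ℙ 1ℙ 0ℙ = ≡.refl
    expand 0ℙ 1ℙ 1ℙ = ≡.refl
    expand 1ℙ 0ℙ 0ℙ = ≡.refl
    expand 1ℙ 0ℙ 1ℙ = ≡.refl
    expand 1ℙ 1ℙ 0ℙ = ≡.refl
    expand 1ℙ 1ℙ 1ℙ = ≡.refl

    split : ∀ i j → lt (r i) (r j) ℙ.* lt (s j) (s i) ≡
            ((lt i j ℙ.* lt (r j) (r i)) ℙ.+ (lt i j ℙ.* lt (s j) (s i))) ℙ.+ e i j
    split i j with i Fin.≟ j
    ... | yes ≡.refl rewrite lt-irrefl i | lt-irrefl (r i) = ≡.refl
    ... | no  i≢j
      rewrite lt-flip {i = r j} {r i} (i≢j ∘ ≡.sym ∘ perm-injective ρ)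
      = expand (lt (r i) (r j)) (lt i j) (lt (s j) (s i))

transpose-fix : (i j k : Fin n) → k ≢ i → k ≢ j → Perm.transpose i j ⟨$⟩ʳ k ≡ k
transpose-fix i j k k≢i k≢j
  rewrite dec-false (k Fin.≟ i) k≢i | dec-false (k Fin.≟ j) k≢j = ≡.refl

transpose-fst : (i j : Fin n) → Perm.transpose i j ⟨$⟩ʳ i ≡ j
transpose-fst i j rewrite dec-true (i Fin.≟ i) ≡.refl = ≡.refl

transpose-snd : (i j : Fin n) → Perm.transpose i j ⟨$⟩ʳ j ≡ i
transpose-snd i j with j Fin.≟ i
... | yes j≡i = j≡i
... | no  _ rewrite dec-true (j Fin.≟ j) ≡.refl = ≡.refl

transpose-involutive : (i j k : Fin n) →
                       Perm.transpose i j ⟨$⟩ʳ (Perm.transpose i j ⟨$⟩ʳ k) ≡ k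
transpose-involutive i j k = helper (k Fin.≟ i) (k Fin.≟ j)
  where
  t = Perm.transpose i j ⟨$⟩ʳ_

  helper : Dec (k ≡ i) → Dec (k ≡ j) → t (t k) ≡ k
  helper (yes ≡.refl) _            = ≡.trans (cong t (transpose-fst i j)) (transpose-snd i j)
  helper (no _)       (yes ≡.refl) = ≡.trans (cong t (transpose-snd i j)) (transpose-fst i j)
  helper (no k≢i)     (no k≢j)     =
    ≡.trans (cong t (transpose-fix i j k k≢i k≢j)) (transpose-fix i j k k≢i k≢j)

-- By `sgn-involution` the sign counts the indices that are moved upwards, and a transposition moves
-- up only the smaller of its two points.
sgn-transpose : {i j : Fin n} → i ≢ j → sgn (Perm.transpose i j) ≡ 1ℙ
sgn-transpose {n} {i} {j} i≢j =
  ≡.trans (sgn-involution (Perm.transpose i j) (transpose-involutive i j)) count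
  where
  t = Perm.transpose i j ⟨$⟩ʳ_

  fixed : ∀ k → k ≢ i → k ≢ j → lt k (t k) ≡ 0ℙ
  fixed k k≢i k≢j = ≡.trans (cong (lt k) (transpose-fix i j k k≢i k≢j)) (lt-irrefl k)

  Rest : Fin n → Fin n → Set
  Rest k l = ∀ m → m ≢ k → Dec (m ≡ l) → lt m (t m) ≡ 0ℙ

  count : sumℙ (λ k → lt k (t k)) ≡ 1ℙ
  count with Fin.<-cmp i j
  ... | tri≈ _ i≡j _ = contradiction i≡j i≢j
  ... | tri< i<j _ j≮i = sumℙ-indicator i _
    (≡.trans (cong (lt i) (transpose-fst i j)) (cong bit (dec-true (i Fin.<? j) i<j)))
    λ k k≢i → others k k≢i (k Fin.≟ j)
    where
    others : Rest i j
    others k k≢i (no k≢j)     = fixed k k≢i k≢j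
    others k k≢i (yes ≡.refl) =
      ≡.trans (cong (lt k) (transpose-snd i k)) (cong bit (dec-false (k Fin.<? i) j≮i))
  ... | tri> i≮j _ j<i = sumℙ-indicator j _
    (≡.trans (cong (lt j) (transpose-snd i j)) (cong bit (dec-true (j Fin.<? i) j<i)))
    λ k k≢j → others k k≢j (k Fin.≟ i)
    where
    others : Rest j i
    others k k≢j (no k≢i)     = fixed k k≢i k≢j
    others k k≢j (yes ≡.refl) =
      ≡.trans (cong (lt k) (transpose-fst k j)) (cong bit (dec-false (k Fin.<? j) i≮j))

sgn-transpose-∘ₚ : {i j : Fin n} → i ≢ j → (σ : Permutation′ n) →
                   sgn (Perm.transpose i j ∘ₚ σ) ≡ 1ℙ ℙ.+ sgn σ
sgn-transpose-∘ₚ {i = i} {j} i≢j σ =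
  ≡.trans (sgn-∘ₚ-involution (Perm.transpose i j) (transpose-involutive i j) σ)
        (cong (ℙ._+ sgn σ) (sgn-transpose i≢j))

-- Enumeration of permutations and subdiagonals

_≈ₚ_ : Rel (Permutation′ n) _
_≈ₚ_ = Perm._≈_

-- A permutation is a record of functions and proofs, so distinctness and reindexing are understood
-- up to pointwise equality of the forward maps.
permutation-setoid : ℕ → Setoid _ _
permutation-setoid n = record
  { Carrier       = Permutation′ n
  ; _≈_           = _≈ₚ_
  ; isEquivalence = record
    { refl  = λ _ → ≡.refl
    ; sym   = λ σ≈τ i → ≡.sym (σ≈τ i)
    ; trans = λ σ≈τ τ≈υ i → ≡.trans (σ≈τ i) (τ≈υ i)
    }
  }

permutations-unique : ∀ n → AllPairs (λ σ τ → ¬ (σ ≈ₚ τ)) (permutations n)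
permutations-unique zero    = [] ∷ []
permutations-unique (suc n) = Uniqueₛ.cartesianProductWith⁺
  (≡.setoid (Fin (suc n))) (permutation-setoid n) (permutation-setoid (suc n))
  (insert zero) insert-injective (allFin⁺ (suc n)) (permutations-unique n)
  where
  insert-injective : ∀ {i j σ τ} → insert zero i σ ≈ₚ insert zero j τ → i ≡ j × σ ≈ₚ τ
  insert-injective {i} {j} {σ} {τ} eq with eq zero
  ... | ≡.refl = ≡.refl , λ k → Fin.punchIn-injective i _ _
    (≡.trans (≡.sym (insert-punchIn zero i σ k)) (≡.trans (eq (suc k)) (insert-punchIn zero i τ k)))

deduplicate-unique : (_≟_ : DecidableEquality A) {xs : List A} → Unique xs → deduplicate _≟_ xs ≡ xs
deduplicate-unique _≟_ []           = ≡.refl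
deduplicate-unique _≟_ {x ∷ xs} (x∉ ∷ xs!) = cong (x ∷_)
  (≡.trans (cong (filter (λ y → ¬? (x ≟ y))) (deduplicate-unique _≟_ xs!))
         (List.filter-all (λ y → ¬? (x ≟ y)) x∉))

-- Separation is asked only for members of `ys`: two permutations may agree on an arbitrary vector
-- of rows, and it is membership in `choose` that guarantees enough rows to tell them apart.
cartesianProductWith-unique : ∀ {r} {R : Rel A r} (f : A → B → C) {xs : List A} {ys : List B} →
  (∀ {x y y′} → f x y ≡ f x y′ → y ≡ y′) →
  (∀ {x x′ y y′} → R x x′ → y ∈ ys → y′ ∈ ys → f x y ≢ f x′ y′) →
  AllPairs R xs → Unique ys → Unique (cartesianProductWith f xs ys)
cartesianProductWith-unique f inj sep []           ys! = []
cartesianProductWith-unique f {x ∷ xs} {ys} inj sep (Rx ∷ xs!) ys! =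
  Unique.++⁺ (Unique.map⁺ inj ys!) (cartesianProductWith-unique f inj sep xs! ys!) disjoint
  where
  disjoint : ∀ {z} → ¬ (z ∈ map (f x) ys × z ∈ cartesianProductWith f xs ys)
  disjoint (z∈l , z∈r)
    with y , y∈ , z≡ ← ∈-map⁻ (f x) z∈l
       | x′ , y′ , x′∈ , y′∈ , z≡′ ← ∈-cartesianProductWith⁻ f xs ys z∈r
    = sep (All.lookup Rx x′∈) y∈ y′∈ (≡.trans (≡.sym z≡) z≡′)

choose-⊆ : ∀ k (xs : List A) {v y} → v ∈ choose k xs → y ∈ᵥ v → y ∈ xs
choose-⊆ zero    xs (here ≡.refl) ()
choose-⊆ (suc k) (x ∷ xs) v∈ y∈ with ∈-++⁻ (map (x ∷_) (choose k xs)) v∈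
... | inj₂ v∈r = there (choose-⊆ (suc k) xs v∈r y∈)
... | inj₁ v∈l with ∈-map⁻ (x ∷_) v∈l
choose-⊆ (suc k) (x ∷ xs) v∈ (here ≡.refl) | inj₁ v∈l | w , w∈ , ≡.refl = here ≡.refl
choose-⊆ (suc k) (x ∷ xs) v∈ (there y∈)  | inj₁ v∈l | w , w∈ , ≡.refl = there (choose-⊆ k xs w∈ y∈)

choose-unique : ∀ k {xs : List A} → Unique xs → Unique (choose k xs)
choose-unique zero    xs!        = [] ∷ []
choose-unique (suc k) []         = []
choose-unique (suc k) {x ∷ xs} (x∉ ∷ xs!) =
  Unique.++⁺ (Unique.map⁺ Vec.∷-injectiveʳ (choose-unique k xs!)) (choose-unique (suc k) xs!) disjoint
  where
  disjoint : ∀ {z} → ¬ (z ∈ map (x ∷_) (choose k xs) × z ∈ choose (suc k) xs)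
  disjoint (z∈l , z∈r) with w , _ , ≡.refl ← ∈-map⁻ (x ∷_) z∈l =
    All.lookup x∉ (choose-⊆ (suc k) xs z∈r (here ≡.refl)) ≡.refl

choose-short : ∀ k {xs : List A} → length xs ℕ.< k → choose k xs ≡ []
choose-short (suc k) {[]}     _         = ≡.refl
choose-short (suc k) {x ∷ xs} (s≤s len) =
  cong₂ (λ vs ws → map (x ∷_) vs ++ ws)
    (choose-short k {xs} len) (choose-short (suc k) {xs} (ℕ.m<n⇒m<1+n len))

choose-all : ∀ k (xs : List A) {v y} → length xs ℕ.≤ k → v ∈ choose k xs → y ∈ xs → y ∈ᵥ v
choose-all (suc k) (x ∷ xs) (s≤s len) v∈ y∈ with ∈-++⁻ (map (x ∷_) (choose k xs)) v∈
... | inj₂ v∈r with () ← subst (_ ∈_) (choose-short (suc k) {xs} (s≤s len)) v∈r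
... | inj₁ v∈l with ∈-map⁻ (x ∷_) v∈l
choose-all (suc k) (x ∷ xs) (s≤s len) v∈ (here ≡.refl) | inj₁ v∈l | w , w∈ , ≡.refl = here ≡.refl
choose-all (suc k) (x ∷ xs) (s≤s len) v∈ (there y∈)  | inj₁ v∈l | w , w∈ , ≡.refl =
  there (choose-all k xs len w∈ y∈)

-- At most one position is dropped. The disjunction over pairs expresses this without naming the
-- dropped position, in the form that `agree-all-but-one` consumes.
choose-all-but-one : ∀ k (xs : List A) {v y z} → length xs ℕ.≤ suc k → v ∈ choose k xs →
                     y ∈ xs → z ∈ xs → y ≢ z → y ∈ᵥ v ⊎ z ∈ᵥ v
choose-all-but-one zero    (x ∷ []) len v∈ (here ≡.refl) (here ≡.refl) y≢z = contradiction ≡.refl y≢z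
choose-all-but-one zero    (x ∷ []) len v∈ (here ≡.refl) (there ()) y≢z
choose-all-but-one zero    (x ∷ []) len v∈ (there ()) z∈ y≢z
choose-all-but-one zero    (x ∷ _ ∷ _) (s≤s ()) v∈ y∈ z∈ y≢z
choose-all-but-one (suc k) (x ∷ xs) (s≤s len) v∈ y∈ z∈ y≢z with ∈-++⁻ (map (x ∷_) (choose k xs)) v∈
choose-all-but-one (suc k) (x ∷ xs) (s≤s len) v∈ (here ≡.refl) (here ≡.refl) y≢z | inj₂ v∈r =
  contradiction ≡.refl y≢z
choose-all-but-one (suc k) (x ∷ xs) (s≤s len) v∈ (there y∈) z∈ y≢z | inj₂ v∈r =
  inj₁ (choose-all (suc k) xs len v∈r y∈)
choose-all-but-one (suc k) (x ∷ xs) (s≤s len) v∈ (here ≡.refl) (there z∈) y≢z | inj₂ v∈r =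
  inj₂ (choose-all (suc k) xs len v∈r z∈)
choose-all-but-one (suc k) (x ∷ xs) (s≤s len) v∈ y∈ z∈ y≢z | inj₁ v∈l with ∈-map⁻ (x ∷_) v∈l
choose-all-but-one (suc k) (x ∷ xs) (s≤s len) v∈ (here ≡.refl) z∈ y≢z | inj₁ _ | w , w∈ , ≡.refl =
  inj₁ (here ≡.refl)
choose-all-but-one (suc k) (x ∷ xs) (s≤s len) v∈ (there y∈) (here ≡.refl) y≢z | inj₁ _ | w , w∈ , ≡.refl =
  inj₂ (here ≡.refl)
choose-all-but-one (suc k) (x ∷ xs) (s≤s len) v∈ (there y∈) (there z∈) y≢z | inj₁ _ | w , w∈ , ≡.refl
  with choose-all-but-one k xs len w∈ y∈ z∈ y≢z
... | inj₁ y∈w = inj₁ (there y∈w)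
... | inj₂ z∈w = inj₂ (there z∈w)

subdiagonal-rows : (σ : Permutation′ n) (v : Vec (Fin n) k) → Vec.map proj₁ (subdiagonal σ v) ≡ v
subdiagonal-rows σ v = ≡.trans (≡.sym (Vec.map-∘ proj₁ _ v)) (Vec.map-id v)

subdiagonal-agree : (σ τ : Permutation′ n) (v : Vec (Fin n) k) → subdiagonal σ v ≡ subdiagonal τ v →
                    ∀ {i} → i ∈ᵥ v → σ ⟨$⟩ʳ i ≡ τ ⟨$⟩ʳ i
subdiagonal-agree σ τ (x ∷ v) eq (here ≡.refl) = cong proj₂ (Vec.∷-injectiveˡ eq)
subdiagonal-agree σ τ (x ∷ v) eq (there i∈)  = subdiagonal-agree σ τ v (Vec.∷-injectiveʳ eq) i∈

-- Compare `i` with j = τ⁻¹(σ i). If they differ, agreement at j would give σ j = τ j = σ i, against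
-- injectivity of σ; so the agreement is at `i`.
agree-all-but-one : (σ τ : Permutation′ n) →
  (∀ {i j} → i ≢ j → σ ⟨$⟩ʳ i ≡ τ ⟨$⟩ʳ i ⊎ σ ⟨$⟩ʳ j ≡ τ ⟨$⟩ʳ j) → σ ≈ₚ τ
agree-all-but-one σ τ agree i with i Fin.≟ (τ ⟨$⟩ˡ (σ ⟨$⟩ʳ i))
... | yes eq = ≡.trans (≡.sym (inverseʳ τ)) (cong (τ ⟨$⟩ʳ_) (≡.sym eq))
... | no  i≢j with agree i≢j
...   | inj₁ eq = eq
...   | inj₂ eq = contradiction (perm-injective σ (≡.trans (≡.sym (inverseʳ τ)) (≡.sym eq))) i≢j

-- Equal subdiagonals have the same rows, hence come from permutations that agree on all rows but at
-- most one. The bound admits both lengths occurring in `edet`.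
subdiagonals-unique : ∀ π n k → n ℕ.≤ suc k →
  Unique (cartesianProductWith subdiagonal (permutationsOf π n) (choose k (allFin n)))
subdiagonals-unique π n k n≤1+k = cartesianProductWith-unique subdiagonal
  (λ {σ} {v} {w} → same-rows σ σ v w)
  (λ {σ} {τ} → separate {σ} {τ})
  (Uniqueₛ.filter⁺ (permutation-setoid n) _ (permutations-unique n))
  (choose-unique k (allFin⁺ n))
  where
  same-rows : ∀ σ τ (v w : Vec (Fin n) k) → subdiagonal σ v ≡ subdiagonal τ w → v ≡ w
  same-rows σ τ v w eq =
    ≡.trans (≡.sym (subdiagonal-rows σ v)) (≡.trans (cong (Vec.map proj₁) eq) (subdiagonal-rows τ w))

  len : length (allFin n) ℕ.≤ suc k
  len = subst (ℕ._≤ suc k) (≡.sym (List.length-tabulate id)) n≤1+k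

  separate : ∀ {σ τ v w} → ¬ (σ ≈ₚ τ) → v ∈ choose k (allFin n) → w ∈ choose k (allFin n) →
             subdiagonal σ v ≢ subdiagonal τ w
  separate {σ} {τ} {v} {w} σ≉τ v∈ w∈ eq with ≡.refl ← same-rows σ τ v w eq =
    σ≉τ (agree-all-but-one σ τ agree)
    where
    agree : ∀ {i j} → i ≢ j → σ ⟨$⟩ʳ i ≡ τ ⟨$⟩ʳ i ⊎ σ ⟨$⟩ʳ j ≡ τ ⟨$⟩ʳ j
    agree i≢j with choose-all-but-one k (allFin n) len v∈ (∈-allFin _) (∈-allFin _) i≢j
    ... | inj₁ i∈ = inj₁ (subdiagonal-agree σ τ v eq i∈)
    ... | inj₂ j∈ = inj₂ (subdiagonal-agree σ τ v eq j∈)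

L-complete : ∀ π n k → n ℕ.≤ suc k →
  L π n k ≡ cartesianProductWith subdiagonal (permutationsOf π n) (choose k (allFin n))
L-complete π n k n≤1+k = deduplicate-unique _≟ˢ_ (subdiagonals-unique π n k n≤1+k)

-- Finite sums in a ring without unit, and their reindexing

module _ {c ℓ} (K : RingWithoutOne c ℓ) where

  open RingWithoutOne K hiding (zero)
  open import Algebra.Properties.RingWithoutOne K
  open import Algebra.Properties.CommutativeMonoid.Sum (AbelianGroup.commutativeMonoid +-abelianGroup)
    using (sum; sum-cong-≋; sum-permute; ∑-distrib-+)
  open import Algebra.Properties.CommutativeMonoid.Mult (AbelianGroup.commutativeMonoid +-abelianGroup)
    using (×-congʳ; ×-distrib-+) renaming (_×_ to _×ᴷ_)
  open import Algebra.Solver.CommutativeMonoid (AbelianGroup.commutativeMonoid +-abelianGroup)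
    using (solve; _⊕_; _⊜_)
  open import Relation.Binary.Reasoning.Setoid setoid

  Congruent : (Carrier → Carrier) → Set _
  Congruent f = ∀ {x y} → x ≈ y → f x ≈ f y

  sub-cong : ∀ {x x′ y y′} → x ≈ x′ → y ≈ y′ → x - y ≈ x′ - y′
  sub-cong x≈ y≈ = +-cong x≈ (-‿cong y≈)

  sub-self : ∀ {x y} → x ≈ y → x - y ≈ 0#
  sub-self {y = y} x≈y = trans (+-congʳ x≈y) (-‿inverseʳ y)

  sub-zeroʳ : ∀ x → x - 0# ≈ x
  sub-zeroʳ x = trans (+-congˡ -0#≈0#) (+-identityʳ x)

  sub-interchange : ∀ w x y z → (w + x) - (y + z) ≈ (w - y) + (x - z)
  sub-interchange w x y z = begin
    (w + x) - (y + z)      ≈⟨ +-congˡ (-‿+-comm y z) ⟨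
    (w + x) + (- y + - z)  ≈⟨ solve 4 (λ a b c d → (a ⊕ b) ⊕ (c ⊕ d) ⊜ (a ⊕ c) ⊕ (b ⊕ d)) refl w x (- y) (- z) ⟩
    (w - y) + (x - z)      ∎

  telescope : ∀ x y z → (x - y) + (y - z) ≈ x - z
  telescope x y z = begin
    (x + - y) + (y + - z)  ≈⟨ solve 4 (λ a b c d → (a ⊕ b) ⊕ (c ⊕ d) ⊜ (a ⊕ d) ⊕ (b ⊕ c)) refl x (- y) y (- z) ⟩
    (x - z) + (- y + y)    ≈⟨ +-congˡ (-‿inverseˡ y) ⟩
    (x - z) + 0#           ≈⟨ +-identityʳ _ ⟩
    x - z                  ∎

  add-sub-cancelˡ : ∀ x y → (x + y) - x ≈ y
  add-sub-cancelˡ = xyx⁻¹≈y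

  ×-neg : ∀ k x → k ×ᴷ (- x) ≈ - (k ×ᴷ x)
  ×-neg zero    x = sym -0#≈0#
  ×-neg (suc k) x = trans (+-congˡ (×-neg k x)) (-‿+-comm x _)

  ∑-cong : (xs : List X) {f g : X → Carrier} → (∀ x → f x ≈ g x) → ∑ K xs f ≈ ∑ K xs g
  ∑-cong []       f≈g = refl
  ∑-cong (x ∷ xs) f≈g = +-cong (f≈g x) (∑-cong xs f≈g)

  ∑-+ : (xs : List X) (f g : X → Carrier) → ∑ K xs (λ x → f x + g x) ≈ ∑ K xs f + ∑ K xs g
  ∑-+ []       f g = sym (+-identityˡ 0#)
  ∑-+ (x ∷ xs) f g = trans (+-congˡ (∑-+ xs f g))
    (solve 4 (λ a b c d → (a ⊕ b) ⊕ (c ⊕ d) ⊜ (a ⊕ c) ⊕ (b ⊕ d)) refl (f x) (g x) _ _)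

  ∑-neg : (xs : List X) (f : X → Carrier) → ∑ K xs (λ x → - f x) ≈ - ∑ K xs f
  ∑-neg []       f = sym -0#≈0#
  ∑-neg (x ∷ xs) f = trans (+-congˡ (∑-neg xs f)) (-‿+-comm (f x) _)

  ∑-++ : (xs ys : List X) (f : X → Carrier) → ∑ K (xs ++ ys) f ≈ ∑ K xs f + ∑ K ys f
  ∑-++ []       ys f = sym (+-identityˡ _)
  ∑-++ (x ∷ xs) ys f = trans (+-congˡ (∑-++ xs ys f)) (sym (+-assoc (f x) _ _))

  ∑-map : (g : X → Y) (xs : List X) (f : Y → Carrier) → ∑ K (map g xs) f ≈ ∑ K xs (f ∘ g)
  ∑-map g []       f = refl
  ∑-map g (x ∷ xs) f = +-congˡ (∑-map g xs f)

  ∑-tabulate : (g : Fin n → X) (f : X → Carrier) → ∑ K (tabulate g) f ≈ sum (f ∘ g)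
  ∑-tabulate {n = zero}  g f = refl
  ∑-tabulate {n = suc n} g f = +-congˡ (∑-tabulate (g ∘ suc) f)

  ∑-cartesianProductWith : (g : X → Y → Z) (xs : List X) (ys : List Y) (f : Z → Carrier) →
    ∑ K (cartesianProductWith g xs ys) f ≈ ∑ K xs (λ x → ∑ K ys (λ y → f (g x y)))
  ∑-cartesianProductWith g []       ys f = refl
  ∑-cartesianProductWith g (x ∷ xs) ys f = trans
    (∑-++ (map (g x) ys) _ f)
    (+-cong (∑-map (g x) ys f) (∑-cartesianProductWith g xs ys f))

  module _ (S : Setoid a b) where
    open Setoid S using () renaming (Carrier to |S|; _≈_ to _≈ₛ_; sym to symₛ; trans to transₛ)

    ∑-remove : (f : |S| → Carrier) → (∀ {x y} → x ≈ₛ y → f x ≈ f y) →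
               {x : |S|} {xs : List |S|} (p : Any (x ≈ₛ_) xs) → ∑ K xs f ≈ f x + ∑ K (xs ─ p) f
    ∑-remove f f-cong (here x≈y) = +-congʳ (sym (f-cong x≈y))
    ∑-remove f f-cong {x} {y ∷ xs} (there p) = trans (+-congˡ (∑-remove f f-cong p))
      (solve 3 (λ a b c → a ⊕ (b ⊕ c) ⊜ b ⊕ (a ⊕ c)) refl (f y) (f x) _)

    ∈-remove : ∀ {x y} {xs : List |S|} (p : Any (x ≈ₛ_) xs) → Any (y ≈ₛ_) xs → ¬ (x ≈ₛ y) →
               Any (y ≈ₛ_) (xs ─ p)
    ∈-remove (here x≈)  (here y≈)  x≉y = contradiction (transₛ x≈ (symₛ y≈)) x≉y
    ∈-remove (here _)   (there q)  x≉y = q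
    ∈-remove (there p)  (here y≈)  x≉y = here y≈
    ∈-remove (there p)  (there q)  x≉y = there (∈-remove p q x≉y)

    -- By counting, xs is a rearrangement of ys.
    ∑-unique-⊆ : (f : |S| → Carrier) → (∀ {x y} → x ≈ₛ y → f x ≈ f y) →
                 {xs ys : List |S|} → AllPairs (λ x y → ¬ (x ≈ₛ y)) xs →
                 All (λ x → Any (x ≈ₛ_) ys) xs → length xs ≡ length ys → ∑ K xs f ≈ ∑ K ys f
    ∑-unique-⊆ f f-cong {ys = []}    []           []        len = refl
    ∑-unique-⊆ f f-cong {x ∷ xs} {ys} (x∉ ∷ xs!) (p ∷ xs⊆) len = trans
      (+-congˡ (∑-unique-⊆ f f-cong xs!
        (All.zipWith (λ (x≉z , q) → ∈-remove p q x≉z) (x∉ , xs⊆))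
        (ℕ.suc-injective (≡.trans len (List.length-removeAt′ ys (Any.index p))))))
      (sym (∑-remove f f-cong p))

  -- Injectivity suffices: the image of the enumeration has no repetitions, lies in the enumeration
  -- up to `_≈ₚ_` and has the same length, so `∑-unique-⊆` applies.
  ∑-permutations-reindex : (g : Permutation′ n → Permutation′ n) →
    (∀ {σ τ} → g σ ≈ₚ g τ → σ ≈ₚ τ) →
    (f : Permutation′ n → Carrier) → (∀ {σ τ} → σ ≈ₚ τ → f σ ≈ f τ) →
    ∑ K (permutations n) f ≈ ∑ K (permutations n) (f ∘ g)
  ∑-permutations-reindex {n} g g-inj f f-cong = trans
    (sym (∑-unique-⊆ (permutation-setoid n) f (λ {σ} {τ} → f-cong {σ} {τ})
      (Uniqueₛ.map⁺ (permutation-setoid n) (permutation-setoid n)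
        (λ {σ} {τ} → g-inj {σ} {τ}) (permutations-unique n))
      (All.tabulate (λ {σ} _ → complete σ))
      (List.length-map g (permutations n))))
    (∑-map g (permutations n) f)
    where
    complete : ∀ σ → Any (σ ≈ₚ_) (permutations n)
    complete σ with τ , τ∈ , τ≈σ ← permutations-complete σ = lose τ∈ (λ i → ≡.sym (τ≈σ i))

  -- Signed sums over permutations

  -- Without a unit there is no element -1 to multiply by, so signs act as an operation.
  signed : Parity → Carrier → Carrier
  signed 0ℙ x = x
  signed 1ℙ x = - x

  signed-cong : ∀ p {x y} → x ≈ y → signed p x ≈ signed p y
  signed-cong 0ℙ x≈y = x≈y
  signed-cong 1ℙ x≈y = -‿cong x≈y

  signed-+ : ∀ p x y → signed p (x + y) ≈ signed p x + signed p y
  signed-+ 0ℙ x y = refl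
  signed-+ 1ℙ x y = sym (-‿+-comm x y)

  signed-neg : ∀ p x → signed p (- x) ≈ - signed p x
  signed-neg 0ℙ x = refl
  signed-neg 1ℙ x = refl

  signed-suc : ∀ p x → signed (1ℙ ℙ.+ p) x ≈ - signed p x
  signed-suc 0ℙ x = refl
  signed-suc 1ℙ x = sym (-‿involutive x)

  signed-sgn-cong : {σ τ : Permutation′ n} → σ ≈ₚ τ → ∀ {x y} → x ≈ y →
                    signed (sgn σ) x ≈ signed (sgn τ) y
  signed-sgn-cong {σ = σ} {τ} σ≈τ {x} x≈y = trans
    (reflexive (cong (λ p → signed p x) (sgn-cong {σ = σ} {τ} σ≈τ)))
    (signed-cong (sgn τ) x≈y)

  alternatingSum : (Permutation′ n → Carrier) → Carrier
  alternatingSum {n} f = ∑ K (permutations n) (λ σ → signed (sgn σ) (f σ))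

  alternatingSum-cong : {f g : Permutation′ n → Carrier} → (∀ σ → f σ ≈ g σ) →
                        alternatingSum f ≈ alternatingSum g
  alternatingSum-cong {n} f≈g = ∑-cong (permutations n) (λ σ → signed-cong (sgn σ) (f≈g σ))

  alternatingSum-+ : (f g : Permutation′ n → Carrier) →
    alternatingSum (λ σ → f σ + g σ) ≈ alternatingSum f + alternatingSum g
  alternatingSum-+ {n} f g = trans (∑-cong (permutations n) (λ σ → signed-+ (sgn σ) (f σ) (g σ)))
                                   (∑-+ (permutations n) _ _)

  alternatingSum-neg : (f : Permutation′ n → Carrier) →
                       alternatingSum (λ σ → - f σ) ≈ - alternatingSum f
  alternatingSum-neg {n} f = trans (∑-cong (permutations n) (λ σ → signed-neg (sgn σ) (f σ)))
                                   (∑-neg (permutations n) _)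

  alternatingSum-sub : (f g : Permutation′ n → Carrier) →
    alternatingSum (λ σ → f σ - g σ) ≈ alternatingSum f - alternatingSum g
  alternatingSum-sub f g = trans (alternatingSum-+ f _) (+-congˡ (alternatingSum-neg g))

  alternatingSum-flip : (f : Permutation′ n → Carrier) → (∀ {σ τ} → σ ≈ₚ τ → f σ ≈ f τ) →
                        alternatingSum f ≈ alternatingSum (f ∘ flip)
  alternatingSum-flip {n} f f-cong = trans
    (∑-permutations-reindex flip (λ {σ} {τ} → flip-injective {σ} {τ}) (λ σ → signed (sgn σ) (f σ))
      (λ {σ} {τ} σ≈τ → signed-sgn-cong {σ = σ} {τ} σ≈τ (f-cong {σ} {τ} σ≈τ)))
    (∑-cong (permutations n) (λ σ → reflexive (cong (λ p → signed p (f (flip σ))) (sgn-flip σ))))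
    where
    flip-injective : {σ τ : Permutation′ n} → flip σ ≈ₚ flip τ → σ ≈ₚ τ
    flip-injective {σ} {τ} eq i = ≡.trans (≡.sym (inverseʳ τ))
      (cong (τ ⟨$⟩ʳ_) (≡.trans (≡.sym (eq (σ ⟨$⟩ʳ i))) (inverseˡ σ)))

  alternatingSum-transpose : {i j : Fin n} → i ≢ j →
    (f : Permutation′ n → Carrier) → (∀ {σ τ} → σ ≈ₚ τ → f σ ≈ f τ) →
    alternatingSum (λ σ → f (Perm.transpose i j ∘ₚ σ)) ≈ - alternatingSum f
  alternatingSum-transpose {n} {i} {j} i≢j f f-cong = begin
    alternatingSum (λ σ → f (ρ ∘ₚ σ))
      ≈⟨ -‿involutive _ ⟨
    -- The inner minus goes into the summands, where it becomes the change of sign between σ and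
    -- `ρ ∘ₚ σ`; the outer one survives.
    - - alternatingSum (λ σ → f (ρ ∘ₚ σ))
      ≈⟨ -‿cong (∑-neg (permutations n) _) ⟨
    - ∑ K (permutations n) (λ σ → - signed (sgn σ) (f (ρ ∘ₚ σ)))
      ≈⟨ -‿cong (∑-cong (permutations n) (λ σ → signed-suc (sgn σ) _)) ⟨
    - ∑ K (permutations n) (λ σ → signed (1ℙ ℙ.+ sgn σ) (f (ρ ∘ₚ σ)))
      ≈⟨ -‿cong (∑-cong (permutations n) (λ σ → reflexive
           (cong (λ p → signed p (f (ρ ∘ₚ σ))) (sgn-transpose-∘ₚ i≢j σ)))) ⟨
    - ∑ K (permutations n) (λ σ → signed (sgn (ρ ∘ₚ σ)) (f (ρ ∘ₚ σ)))
      ≈⟨ -‿cong (∑-permutations-reindex (ρ ∘ₚ_) (λ {σ} {τ} → ρ-injective {σ} {τ}) (λ σ → signed (sgn σ) (f σ))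
          (λ {σ} {τ} σ≈τ → signed-sgn-cong {σ = σ} {τ} σ≈τ (f-cong {σ} {τ} σ≈τ))) ⟨
    - alternatingSum f ∎
    where
    ρ = Perm.transpose i j

    ρ-injective : {σ τ : Permutation′ n} → (ρ ∘ₚ σ) ≈ₚ (ρ ∘ₚ τ) → σ ≈ₚ τ
    ρ-injective {σ} {τ} eq k = ≡.subst (λ l → σ ⟨$⟩ʳ l ≡ τ ⟨$⟩ʳ l) (inverseʳ ρ) (eq (ρ ⟨$⟩ˡ k))

  ∑-even-odd : (xs : List (Permutation′ n)) (f : Permutation′ n → Carrier) →
    ∑ K (filter (λ σ → sgn σ ℙ.≟ 0ℙ) xs) f - ∑ K (filter (λ σ → sgn σ ℙ.≟ 1ℙ) xs) f ≈
    ∑ K xs (λ σ → signed (sgn σ) (f σ))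
  ∑-even-odd []       f = -‿inverseʳ 0#
  ∑-even-odd (σ ∷ xs) f with sgn σ
  ... | 0ℙ = trans (+-assoc (f σ) _ _) (+-congˡ (∑-even-odd xs f))
  ... | 1ℙ = begin
    even - (f σ + odd)      ≈⟨ +-congˡ (-‿+-comm (f σ) odd) ⟨
    even + (- f σ + - odd)  ≈⟨ solve 3 (λ a b c → a ⊕ (b ⊕ c) ⊜ b ⊕ (a ⊕ c)) refl even (- f σ) (- odd) ⟩
    - f σ + (even - odd)    ≈⟨ +-congˡ (∑-even-odd xs f) ⟩
    - f σ + _               ∎
    where
    even = ∑ K (filter (λ σ → sgn σ ℙ.≟ 0ℙ) xs) f
    odd  = ∑ K (filter (λ σ → sgn σ ℙ.≟ 1ℙ) xs) f

  -- Sums over choices of all entries, or of all but one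

  vsum : ∀ {k} → (X → Carrier) → Vec X k → Carrier
  vsum h v = Vec.foldr′ _+_ 0# (Vec.map h v)

  module _ (h : X → Carrier) where

    -- Generality in `f` carries the induction: a chosen head is absorbed by passing to
    -- `λ s → f (h x + s)`.
    ∑-choose-all : ∀ k (xs : List X) → length xs ≡ k →
      (f : Carrier → Carrier) → Congruent f →
      ∑ K (choose k xs) (λ v → f (vsum h v)) ≈ f (∑ K xs h)
    ∑-choose-all zero    []       len f f-cong = +-identityʳ _
    ∑-choose-all (suc k) (x ∷ xs) len f f-cong = begin
      ∑ K (map (x ∷_) (choose k xs) ++ choose (suc k) xs) (λ v → f (vsum h v))
        ≈⟨ reflexive (cong (λ vs → ∑ K (map (x ∷_) (choose k xs) ++ vs) (λ v → f (vsum h v)))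
             (choose-short (suc k) {xs} (s≤s (ℕ.≤-reflexive len′)))) ⟩
      ∑ K (map (x ∷_) (choose k xs) ++ []) (λ v → f (vsum h v))
        ≈⟨ trans (∑-++ (map (x ∷_) (choose k xs)) [] _) (+-identityʳ _) ⟩
      ∑ K (map (x ∷_) (choose k xs)) (λ v → f (vsum h v))
        ≈⟨ ∑-map (x ∷_) (choose k xs) _ ⟩
      ∑ K (choose k xs) (λ v → f (h x + vsum h v))
        ≈⟨ ∑-choose-all k xs len′ (λ s → f (h x + s)) (λ eq → f-cong (+-congˡ eq)) ⟩
      f (h x + ∑ K xs h) ∎
      where len′ = ℕ.suc-injective len

    -- A choice either keeps the head, which is absorbed into `f`, or omits it and takes the whole
    -- tail; the second case supplies the summand belonging to the head.
    ∑-choose-all-but-one : ∀ k (xs : List X) → length xs ≡ suc k →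
      (f : Carrier → Carrier) → Congruent f →
      ∑ K (choose k xs) (λ v → f (vsum h v)) ≈ ∑ K xs (λ x → f (∑ K xs h - h x))
    ∑-choose-all-but-one zero    (x ∷ []) len f f-cong = +-congʳ (f-cong (sym (begin
      (h x + 0#) - h x  ≈⟨ add-sub-cancelˡ (h x) 0# ⟩
      0#                ∎)))
    ∑-choose-all-but-one (suc k) (x ∷ xs) len f f-cong = begin
      ∑ K (map (x ∷_) (choose k xs) ++ choose (suc k) xs) (λ v → f (vsum h v))
        ≈⟨ ∑-++ (map (x ∷_) (choose k xs)) (choose (suc k) xs) _ ⟩
      ∑ K (map (x ∷_) (choose k xs)) (λ v → f (vsum h v)) + ∑ K (choose (suc k) xs) (λ v → f (vsum h v))
        ≈⟨ +-cong (∑-map (x ∷_) (choose k xs) _) (∑-choose-all (suc k) xs len′ f f-cong) ⟩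
      ∑ K (choose k xs) (λ v → f (h x + vsum h v)) + f (∑ K xs h)
        ≈⟨ +-cong (∑-choose-all-but-one k xs len′ (λ s → f (h x + s)) (λ eq → f-cong (+-congˡ eq)))
                  (f-cong (sym (add-sub-cancelˡ (h x) (∑ K xs h)))) ⟩
      ∑ K xs (λ y → f (h x + (∑ K xs h - h y))) + f ((h x + ∑ K xs h) - h x)
        ≈⟨ +-comm _ _ ⟩
      f ((h x + ∑ K xs h) - h x) + ∑ K xs (λ y → f (h x + (∑ K xs h - h y)))
        ≈⟨ +-congˡ (∑-cong xs (λ y → f-cong (sym (+-assoc (h x) (∑ K xs h) (- h y))))) ⟩
      f ((h x + ∑ K xs h) - h x) + ∑ K xs (λ y → f ((h x + ∑ K xs h) - h y)) ∎
      where len′ = ℕ.suc-injective len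

  power-cong : ∀ m {x y} → x ≈ y → _^1+_ K x m ≈ _^1+_ K y m
  power-cong zero    x≈y = x≈y
  power-cong (suc m) x≈y = *-cong x≈y (power-cong m x≈y)

  -- `edet` as an alternating sum over permutations

  diagonal : Matrix K n → Permutation′ n → Vector Carrier n
  diagonal A σ i = A i (σ ⟨$⟩ʳ i)

  diagonal-cong : (A : Matrix K n) {σ τ : Permutation′ n} → σ ≈ₚ τ → ∀ i → diagonal A σ i ≈ diagonal A τ i
  diagonal-cong A σ≈τ i = reflexive (cong (A i) (σ≈τ i))

  su-subdiagonal : ∀ {k} (A : Matrix K n) (σ : Permutation′ n) (v : Vec (Fin n) k) →
                   su K A (subdiagonal σ v) ≡ vsum (diagonal A σ) v
  su-subdiagonal A σ v = cong (Vec.foldr′ _+_ 0#) (≡.sym (Vec.map-∘ _ _ v))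

  -- The terms of the polarization of f along x that omit at most one index.
  topLayers : (Carrier → Carrier) → Vector Carrier n → Carrier
  topLayers f x = f (sum x) - sum (λ k → f (sum x - x k))

  topLayers-cong : {f : Carrier → Carrier} → Congruent f →
                   {x y : Vector Carrier n} → (∀ i → x i ≈ y i) → topLayers f x ≈ topLayers f y
  topLayers-cong {n} f-cong x≈y = sub-cong (f-cong s≈) (sum-cong-≋ {n} (λ k → f-cong (sub-cong s≈ (x≈y k))))
    where s≈ = sum-cong-≋ {n} x≈y

  topLayers-permute : {f : Carrier → Carrier} → Congruent f →
                      (ρ : Permutation′ n) (x : Vector Carrier n) →
                      topLayers f (λ i → x (ρ ⟨$⟩ʳ i)) ≈ topLayers f x
  topLayers-permute {n} {f} f-cong ρ x = sym (sub-cong (f-cong s≈)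
    (trans (sum-permute (λ k → f (sum x - x k)) ρ) (sum-cong-≋ {n} (λ k → f-cong (+-congʳ s≈)))))
    where s≈ = sum-permute x ρ

  ∑-L : ∀ π n k → n ℕ.≤ suc k → (f : Subdiagonal n k → Carrier) →
        ∑ K (L π n k) f ≈
        ∑ K (permutationsOf π n) (λ σ → ∑ K (choose k (allFin n)) (λ v → f (subdiagonal σ v)))
  ∑-L π n k n≤1+k f = trans (reflexive (cong (λ ls → ∑ K ls f) (L-complete π n k n≤1+k)))
                            (∑-cartesianProductWith subdiagonal (permutationsOf π n) _ f)

  module _ (f : Carrier → Carrier) (f-cong : Congruent f) (A : Matrix K n) where

    ∑-L-all : ∀ π → ∑ K (L π n n) (λ l → f (su K A l)) ≈
              ∑ K (permutationsOf π n) (λ σ → f (sum (diagonal A σ)))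
    ∑-L-all π = trans (∑-L π n n (ℕ.n≤1+n n) _) (∑-cong (permutationsOf π n) (λ σ → begin
      ∑ K (choose n (allFin n)) (λ v → f (su K A (subdiagonal σ v)))
        ≈⟨ ∑-cong (choose n (allFin n)) (λ v → reflexive (cong f (su-subdiagonal A σ v))) ⟩
      ∑ K (choose n (allFin n)) (λ v → f (vsum (diagonal A σ) v))
        ≈⟨ ∑-choose-all (diagonal A σ) n (allFin n) (List.length-tabulate id) f f-cong ⟩
      f (∑ K (allFin n) (diagonal A σ))
        ≈⟨ f-cong (∑-tabulate id (diagonal A σ)) ⟩
      f (sum (diagonal A σ)) ∎))

    ∑-L-all-but-one : ∀ {k} → n ≡ suc k → ∀ π → ∑ K (L π n k) (λ l → f (su K A l)) ≈
      ∑ K (permutationsOf π n) (λ σ → sum (λ i → f (sum (diagonal A σ) - diagonal A σ i)))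
    ∑-L-all-but-one {k} n≡ π = trans (∑-L π n k (ℕ.≤-reflexive n≡) _) (∑-cong (permutationsOf π n) (λ σ → begin
      ∑ K (choose k (allFin n)) (λ v → f (su K A (subdiagonal σ v)))
        ≈⟨ ∑-cong (choose k (allFin n)) (λ v → reflexive (cong f (su-subdiagonal A σ v))) ⟩
      ∑ K (choose k (allFin n)) (λ v → f (vsum (diagonal A σ) v))
        ≈⟨ ∑-choose-all-but-one (diagonal A σ) k (allFin n) (≡.trans (List.length-tabulate id) n≡) f f-cong ⟩
      ∑ K (allFin n) (λ i → f (∑ K (allFin n) (diagonal A σ) - diagonal A σ i))
        ≈⟨ ∑-tabulate {n = n} id _ ⟩
      sum (λ i → f (∑ K (allFin n) (diagonal A σ) - diagonal A σ i))
        ≈⟨ sum-cong-≋ {n} (λ i → f-cong (+-congʳ (∑-tabulate id (diagonal A σ)))) ⟩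
      sum (λ i → f (sum (diagonal A σ) - diagonal A σ i)) ∎))

  ∑-sub : (xs : List X) (f g : X → Carrier) → ∑ K xs (λ x → f x - g x) ≈ ∑ K xs f - ∑ K xs g
  ∑-sub xs f g = trans (∑-+ xs f _) (+-congˡ (∑-neg xs g))

  module _ (div : DivisionByIntegers K) where

    -- Multiplication by n! undoes the division. The leading minus regroups the braces into an even
    -- part minus an odd part, each of the form `T - U`: `T` comes from the full diagonals, `U` from
    -- those with one entry omitted.
    !·edet : ∀ m (A : Matrix K (suc m)) →
             _·_ K (+ (suc m !)) (edet K div A) ≈
             alternatingSum (λ σ → topLayers (λ x → _^1+_ K x m) (diagonal A σ))
    !·edet m A = begin
      _·_ K (+ (suc m !)) (edet K div A)
        ≈⟨ ×-neg (suc m !) _ ⟩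
      - _·_ K (+ (suc m !)) (1/_·_ K div (+ (suc m !)) {{ℕ._!≢0 (suc m)}} _)
        ≈⟨ -‿cong (proj₂ (proj₂ (div (+ (suc m !)) {{ℕ._!≢0 (suc m)}}) _) refl) ⟩
      - (S 0ℙ m - S 1ℙ m + S 1ℙ (suc m) - S 0ℙ (suc m))
        ≈⟨ -‿cong (sub-cong (+-cong (sub-cong (one 0ℙ) (one 1ℙ)) (all 1ℙ)) (all 0ℙ)) ⟩
      - (U 0ℙ - U 1ℙ + T 1ℙ - T 0ℙ)
        ≈⟨ regroup (U 0ℙ) (U 1ℙ) (T 1ℙ) (T 0ℙ) ⟩
      (T 0ℙ - U 0ℙ) - (T 1ℙ - U 1ℙ)
        ≈⟨ sub-cong (∑-sub (permutationsOf 0ℙ (suc m)) _ _) (∑-sub (permutationsOf 1ℙ (suc m)) _ _) ⟨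
      ∑ K (permutationsOf 0ℙ (suc m)) (λ σ → topLayers f (diagonal A σ)) -
      ∑ K (permutationsOf 1ℙ (suc m)) (λ σ → topLayers f (diagonal A σ))
        ≈⟨ ∑-even-odd (permutations (suc m)) _ ⟩
      alternatingSum (λ σ → topLayers f (diagonal A σ)) ∎
      where
      f : Carrier → Carrier
      f x = _^1+_ K x m

      S : Parity → ℕ → Carrier
      S π k = ∑ K (L π (suc m) k) (λ l → f (su K A l))

      T U : Parity → Carrier
      T π = ∑ K (permutationsOf π (suc m)) (λ σ → f (sum (diagonal A σ)))
      U π = ∑ K (permutationsOf π (suc m)) (λ σ → sum (λ i → f (sum (diagonal A σ) - diagonal A σ i)))

      all : ∀ π → S π (suc m) ≈ T π
      all = ∑-L-all f (power-cong m) A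

      one : ∀ π → S π m ≈ U π
      one = ∑-L-all-but-one f (power-cong m) A ≡.refl

      regroup : ∀ u u′ t′ t → - (u - u′ + t′ - t) ≈ (t - u) - (t′ - u′)
      regroup u u′ t′ t = begin
        - (u - u′ + t′ - t)
          ≈⟨ ⁻¹-anti-homo‿- (u - u′ + t′) t ⟩
        t - (u - u′ + t′)
          ≈⟨ +-congˡ (trans (sym (-‿+-comm (u - u′) t′)) (+-congʳ (⁻¹-anti-homo‿- u u′))) ⟩
        t + ((u′ - u) + - t′)
          ≈⟨ solve 4 (λ a b c d → a ⊕ ((b ⊕ c) ⊕ d) ⊜ (a ⊕ c) ⊕ (b ⊕ d)) refl t u′ (- u) (- t′) ⟩
        (t - u) + (u′ - t′)
          ≈⟨ +-congˡ (⁻¹-anti-homo‿- t′ u′) ⟨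
        (t - u) - (t′ - u′) ∎

  -- Finite differences and polarization

  Δ : Carrier → (Carrier → Carrier) → Carrier → Carrier
  Δ x f y = f (y + x) - f y

  Δ-congruent : ∀ x {f} → Congruent f → Congruent (Δ x f)
  Δ-congruent x f-cong y≈ = sub-cong (f-cong (+-congʳ y≈)) (f-cong y≈)

  Δ-cong : ∀ x {f g} → (∀ y → f y ≈ g y) → ∀ y → Δ x f y ≈ Δ x g y
  Δ-cong x f≈g y = sub-cong (f≈g (y + x)) (f≈g y)

  Δ-+-function : ∀ x f g y → Δ x (λ z → f z + g z) y ≈ Δ x f y + Δ x g y
  Δ-+-function x f g y = sub-interchange (f (y + x)) (g (y + x)) (f y) (g y)

  -- The defect of additivity in the step is a difference of one order more, so it disappears once
  -- that order exceeds the degree.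
  Δ-+ : ∀ {f} → Congruent f → ∀ u v y → Δ (u + v) f y ≈ (Δ u f y + Δ v f y) + Δ u (Δ v f) y
  Δ-+ {f} f-cong u v y = begin
    f (y + (u + v)) - f y
      ≈⟨ +-congʳ (f-cong (+-assoc y u v)) ⟨
    f ((y + u) + v) - f y
      ≈⟨ telescope _ (f (y + u)) _ ⟨
    Δ v f (y + u) + Δ u f y
      ≈⟨ +-congʳ (trans (+-comm _ _) (trans (+-assoc _ _ _) (trans (+-congˡ (-‿inverseˡ _)) (+-identityʳ _)))) ⟨
    (Δ v f y + (Δ v f (y + u) - Δ v f y)) + Δ u f y
      ≈⟨ solve 3 (λ a b c → (a ⊕ b) ⊕ c ⊜ (c ⊕ a) ⊕ b) refl (Δ v f y) (Δ u (Δ v f) y) (Δ u f y) ⟩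
    (Δ u f y + Δ v f y) + Δ u (Δ v f) y ∎

  -- Polynomial degree in the sense of Fréchet, which needs neither coefficients nor commuting
  -- variables.
  Degree≤ : ℕ → (Carrier → Carrier) → Set _
  Degree≤ zero    f = ∀ x y → Δ x f y ≈ 0#
  Degree≤ (suc d) f = ∀ x → Degree≤ d (Δ x f)

  degree-cong : ∀ d {f g} → (∀ y → f y ≈ g y) → Degree≤ d f → Degree≤ d g
  degree-cong zero    f≈g p x y = trans (sym (Δ-cong x f≈g y)) (p x y)
  degree-cong (suc d) f≈g p x   = degree-cong d (Δ-cong x f≈g) (p x)

  degree-+ : ∀ d {f g} → Degree≤ d f → Degree≤ d g → Degree≤ d (λ y → f y + g y)
  degree-+ zero    {f} {g} p q x y = trans (Δ-+-function x f g y)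
    (trans (+-cong (p x y) (q x y)) (+-identityʳ 0#))
  degree-+ (suc d) {f} {g} p q x   =
    degree-cong d (λ y → sym (Δ-+-function x f g y)) (degree-+ d (p x) (q x))

  degree-*ˡ : ∀ d z {f} → Degree≤ d f → Degree≤ d (λ y → z * f y)
  degree-*ˡ zero    z p x y = trans (sym (x[y-z]≈xy-xz z _ _)) (trans (*-congˡ (p x y)) (zeroʳ z))
  degree-*ˡ (suc d) z p x   = degree-cong d (λ y → x[y-z]≈xy-xz z _ _) (degree-*ˡ d z (p x))

  -- The constant `z` keeps the induction closed: in the Leibniz rule, a difference with step `x`
  -- turns the factor `z + y` into `(z + x) + y` in front of `Δ x f`, and leaves `x * f y`, of
  -- degree at most `d`.
  degree-linear-* : ∀ d z {f} → Degree≤ d f → Degree≤ (suc d) (λ y → (z + y) * f y)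
  degree-linear-* d z {f} p x = degree-cong d (λ y → sym (leibniz y)) (summands d p)
    where
    leibniz : ∀ y → Δ x (λ y → (z + y) * f y) y ≈ ((z + x) + y) * Δ x f y + x * f y
    leibniz y = begin
      (z + (y + x)) * f (y + x) - (z + y) * f y
        ≈⟨ +-congʳ (*-congʳ (solve 3 (λ a b c → a ⊕ (b ⊕ c) ⊜ (a ⊕ c) ⊕ b) refl z y x)) ⟩
      ((z + x) + y) * f (y + x) - (z + y) * f y
        ≈⟨ telescope _ (((z + x) + y) * f y) _ ⟨
      (((z + x) + y) * f (y + x) - ((z + x) + y) * f y) + (((z + x) + y) * f y - (z + y) * f y)
        ≈⟨ +-cong (x[y-z]≈xy-xz _ _ _) ([y-z]x≈yx-zx _ _ _) ⟨
      ((z + x) + y) * Δ x f y + (((z + x) + y) - (z + y)) * f y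
        ≈⟨ +-congˡ (*-congʳ (trans
             (+-congʳ (solve 3 (λ a b c → (a ⊕ b) ⊕ c ⊜ (a ⊕ c) ⊕ b) refl z x y))
             (add-sub-cancelˡ (z + y) x))) ⟩
      ((z + x) + y) * Δ x f y + x * f y ∎

    summands : ∀ d → Degree≤ d f → Degree≤ d (λ y → ((z + x) + y) * Δ x f y + x * f y)
    -- At degree zero `Δ x f` vanishes, and the first summand with it.
    summands zero    p = degree-+ zero
      (λ w y → sub-self (trans (vanishing (y + w)) (sym (vanishing y))))
      (degree-*ˡ zero x p)
      where
      vanishing : ∀ y → ((z + x) + y) * Δ x f y ≈ 0#
      vanishing y = trans (*-congˡ (p x y)) (zeroʳ _)
    summands (suc d) p = degree-+ (suc d) (degree-linear-* d (z + x) (p x)) (degree-*ˡ (suc d) x p)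

  degree-power : ∀ m → Degree≤ (suc m) (λ x → _^1+_ K x m)
  degree-power zero x w y =
    sub-self (trans (add-sub-cancelˡ (y + w) x) (sym (add-sub-cancelˡ y x)))
  -- With `z` equal to `0#`, the product `y * f y` takes the form covered by `degree-linear-*`.
  degree-power (suc m) = degree-cong (suc (suc m)) (λ y → *-congʳ (+-identityˡ y))
    (degree-linear-* (suc m) 0# (degree-power m))

  Δ* : Vector Carrier n → (Carrier → Carrier) → Carrier → Carrier
  Δ* {zero}  x f = f
  Δ* {suc n} x f = Δ* (tail x) (Δ (head x) f)

  Δ*-function-cong : (x : Vector Carrier n) {f g : Carrier → Carrier} → (∀ y → f y ≈ g y) →
                     ∀ y → Δ* x f y ≈ Δ* x g y
  Δ*-function-cong {zero}  x f≈g = f≈g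
  Δ*-function-cong {suc n} x f≈g = Δ*-function-cong (tail x) (Δ-cong (head x) f≈g)

  Δ*-cong : {x x′ : Vector Carrier n} → (∀ i → x i ≈ x′ i) →
            {f : Carrier → Carrier} → Congruent f → ∀ y → Δ* x f y ≈ Δ* x′ f y
  Δ*-cong {zero}  x≈ f-cong y = refl
  Δ*-cong {suc n} {x} {x′} x≈ {f} f-cong y = trans
    (Δ*-cong {n} (λ i → x≈ (suc i)) (Δ-congruent (head x) {f} f-cong) y)
    (Δ*-function-cong (tail x′) (λ z → +-congʳ (f-cong (+-congˡ (x≈ zero)))) y)

  Δ*-+-function : (x : Vector Carrier n) (f g : Carrier → Carrier) →
                  ∀ y → Δ* x (λ z → f z + g z) y ≈ Δ* x f y + Δ* x g y
  Δ*-+-function {zero}  x f g y = refl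
  Δ*-+-function {suc n} x f g y = trans
    (Δ*-function-cong (tail x) (Δ-+-function (head x) f g) y)
    (Δ*-+-function (tail x) (Δ (head x) f) (Δ (head x) g) y)

  Δ*-vanish : ∀ d (x : Vector Carrier (suc d)) f → Degree≤ d f → ∀ y → Δ* x f y ≈ 0#
  Δ*-vanish zero    x f p = p (head x)
  Δ*-vanish (suc d) x f p = Δ*-vanish d (tail x) (Δ (head x) f) (p (head x))

  Δ*-additive : (x : Vector Carrier n) (r : Fin n) (u v : Carrier) {f : Carrier → Carrier} →
    Congruent f → Degree≤ n f → ∀ y →
    Δ* (updateAt x r (const (u + v))) f y ≈
    Δ* (updateAt x r (const u)) f y + Δ* (updateAt x r (const v)) f y
  Δ*-additive {suc n} x zero    u v {f} f-cong p y = begin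
    Δ* (tail x) (Δ (u + v) f) y
      ≈⟨ Δ*-function-cong (tail x) (Δ-+ {f} f-cong u v) y ⟩
    Δ* (tail x) (λ z → (Δ u f z + Δ v f z) + Δ u (Δ v f) z) y
      ≈⟨ Δ*-+-function (tail x) (λ z → Δ u f z + Δ v f z) (Δ u (Δ v f)) y ⟩
    Δ* (tail x) (λ z → Δ u f z + Δ v f z) y + Δ* (tail x) (Δ u (Δ v f)) y
      ≈⟨ +-cong (Δ*-+-function (tail x) (Δ u f) (Δ v f) y)
                -- The step `v` lowers the degree to `n`; the step `u` and the `n` steps of the tail
                -- are then one more than this degree allows.
                (Δ*-vanish n (u Vector.∷ tail x) (Δ v f) (p v) y) ⟩
    (Δ* (tail x) (Δ u f) y + Δ* (tail x) (Δ v f) y) + 0#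
      ≈⟨ +-identityʳ _ ⟩
    Δ* (tail x) (Δ u f) y + Δ* (tail x) (Δ v f) y ∎
  Δ*-additive {suc n} x (suc r) u v {f} f-cong p y =
    Δ*-additive (tail x) r u v (Δ-congruent (head x) {f} f-cong) (p (head x)) y

  -- Inclusion-exclusion over sets of retained indices

  -- An entry true of the argument of Θ marks a retained index.
  inclusionExclusion : ∀ n → (Vec Bool n → Carrier) → Carrier
  inclusionExclusion zero    Θ = Θ []
  inclusionExclusion (suc n) Θ =
    inclusionExclusion n (λ m → Θ (true ∷ m)) - inclusionExclusion n (λ m → Θ (false ∷ m))

  inclusionExclusion-cong : ∀ n {Θ Ξ : Vec Bool n → Carrier} → (∀ m → Θ m ≈ Ξ m) →
                            inclusionExclusion n Θ ≈ inclusionExclusion n Ξ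
  inclusionExclusion-cong zero    eq = eq []
  inclusionExclusion-cong (suc n) eq = sub-cong
    (inclusionExclusion-cong n (λ m → eq (true ∷ m)))
    (inclusionExclusion-cong n (λ m → eq (false ∷ m)))

  inclusionExclusion-sub : ∀ n (Θ Ξ : Vec Bool n → Carrier) →
    inclusionExclusion n (λ m → Θ m - Ξ m) ≈ inclusionExclusion n Θ - inclusionExclusion n Ξ
  inclusionExclusion-sub zero    Θ Ξ = refl
  inclusionExclusion-sub (suc n) Θ Ξ = begin
    inclusionExclusion n (λ m → Θ (true ∷ m) - Ξ (true ∷ m)) -
    inclusionExclusion n (λ m → Θ (false ∷ m) - Ξ (false ∷ m))
      ≈⟨ sub-cong (inclusionExclusion-sub n _ _) (inclusionExclusion-sub n _ _) ⟩
    (Θᵗ - Ξᵗ) - (Θᶠ - Ξᶠ)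
      ≈⟨ +-congˡ (trans (⁻¹-anti-homo‿- Θᶠ Ξᶠ) (trans (+-comm Ξᶠ (- Θᶠ)) (+-congˡ (sym (-‿involutive Ξᶠ))))) ⟩
    (Θᵗ - Ξᵗ) + (- Θᶠ - - Ξᶠ)
      ≈⟨ sub-interchange Θᵗ (- Θᶠ) Ξᵗ (- Ξᶠ) ⟨
    (Θᵗ - Θᶠ) - (Ξᵗ - Ξᶠ) ∎
    where
    Θᵗ = inclusionExclusion n (λ m → Θ (true ∷ m))
    Ξᵗ = inclusionExclusion n (λ m → Ξ (true ∷ m))
    Θᶠ = inclusionExclusion n (λ m → Θ (false ∷ m))
    Ξᶠ = inclusionExclusion n (λ m → Ξ (false ∷ m))

  masked : Vec Bool n → Vector Carrier n → Carrier
  masked []      x = 0#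
  masked (b ∷ m) x = (if b then head x else 0#) + masked m (tail x)

  masked-cong : (m : Vec Bool n) {x y : Vector Carrier n} →
                (∀ i → lookup m i ≡ true → x i ≈ y i) → masked m x ≈ masked m y
  masked-cong []          eq = refl
  masked-cong (false ∷ m) eq = +-congˡ (masked-cong m (λ i → eq (suc i)))
  masked-cong (true ∷ m)  eq = +-cong (eq zero ≡.refl) (masked-cong m (λ i → eq (suc i)))

  full : Vec Bool n
  full = Vec.replicate _ true

  omit : Fin n → Vec Bool n
  omit zero    = false ∷ full
  omit (suc k) = true ∷ omit k

  masked-full : (x : Vector Carrier n) → masked full x ≈ sum x
  masked-full {zero}  x = refl
  masked-full {suc n} x = +-congˡ (masked-full (tail x))

  masked-omit : (x : Vector Carrier n) (k : Fin n) → masked (omit k) x ≈ sum x - x k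
  masked-omit {suc n} x zero    = trans (+-identityˡ _)
    (trans (masked-full (tail x)) (sym (add-sub-cancelˡ (head x) (sum (tail x)))))
  masked-omit {suc n} x (suc k) = trans (+-congˡ (masked-omit (tail x) k)) (sym (+-assoc _ _ _))

  -- Each difference either keeps its step or drops it at the cost of a minus sign, which is the
  -- recursion of `inclusionExclusion`.
  polarization : (x : Vector Carrier n) {f : Carrier → Carrier} → Congruent f → ∀ y →
                 Δ* x f y ≈ inclusionExclusion n (λ m → f (y + masked m x))
  polarization {zero}  x f-cong y = f-cong (sym (+-identityʳ y))
  polarization {suc n} x {f} f-cong y = begin
    Δ* (tail x) (Δ (head x) f) y
      ≈⟨ polarization (tail x) (Δ-congruent (head x) {f} f-cong) y ⟩
    inclusionExclusion n (λ m → f ((y + masked m (tail x)) + head x) - f (y + masked m (tail x)))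
      ≈⟨ inclusionExclusion-sub n _ _ ⟩
    inclusionExclusion n (λ m → f ((y + masked m (tail x)) + head x)) -
    inclusionExclusion n (λ m → f (y + masked m (tail x)))
      ≈⟨ sub-cong
           (inclusionExclusion-cong n (λ m → f-cong
             (solve 3 (λ a b c → (a ⊕ b) ⊕ c ⊜ a ⊕ (c ⊕ b)) refl y _ (head x))))
           (inclusionExclusion-cong n (λ m → f-cong (+-congˡ (sym (+-identityˡ _))))) ⟩
    inclusionExclusion n (λ m → f (y + (head x + masked m (tail x)))) -
    inclusionExclusion n (λ m → f (y + (0# + masked m (tail x)))) ∎

  inclusionExclusion-zero : ∀ n (Θ : Vec Bool n → Carrier) → (∀ m → Θ m ≈ 0#) → inclusionExclusion n Θ ≈ 0#
  inclusionExclusion-zero zero    Θ Θ≈0 = Θ≈0 []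
  inclusionExclusion-zero (suc n) Θ Θ≈0 = sub-self (trans
    (inclusionExclusion-zero n _ (λ m → Θ≈0 (true ∷ m)))
    (sym (inclusionExclusion-zero n _ (λ m → Θ≈0 (false ∷ m)))))

  inclusionExclusion-full : ∀ n (Θ : Vec Bool n → Carrier) →
    (∀ m i → lookup m i ≡ false → Θ m ≈ 0#) → inclusionExclusion n Θ ≈ Θ full
  inclusionExclusion-full zero    Θ Θ≈0 = refl
  inclusionExclusion-full (suc n) Θ Θ≈0 = trans
    (sub-cong
      (inclusionExclusion-full n _ (λ m i → Θ≈0 (true ∷ m) (suc i)))
      (inclusionExclusion-zero n _ (λ m → Θ≈0 (false ∷ m) zero ≡.refl)))
    (sub-zeroʳ _)

  -- A mask carries one minus sign for each omitted index. Once the head is omitted, any further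
  -- omission is a second one, so that branch reduces to its full mask by `inclusionExclusion-full`.
  inclusionExclusion-topLayers : ∀ n (Θ : Vec Bool n → Carrier) →
    (∀ m i j → i ≢ j → lookup m i ≡ false → lookup m j ≡ false → Θ m ≈ 0#) →
    inclusionExclusion n Θ ≈ Θ full - sum (λ k → Θ (omit k))
  inclusionExclusion-topLayers zero    Θ Θ≈0 = sym (sub-zeroʳ _)
  inclusionExclusion-topLayers (suc n) Θ Θ≈0 = begin
    inclusionExclusion n (λ m → Θ (true ∷ m)) - inclusionExclusion n (λ m → Θ (false ∷ m))
      ≈⟨ sub-cong
           (inclusionExclusion-topLayers n _ (λ m i j i≢j →
             Θ≈0 (true ∷ m) (suc i) (suc j) (i≢j ∘ Fin.suc-injective)))
           (inclusionExclusion-full n _ (λ m i → Θ≈0 (false ∷ m) zero (suc i) (λ ()) ≡.refl)) ⟩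
    (Θ full - sum (λ k → Θ (omit (suc k)))) - Θ (omit zero)
      ≈⟨ +-assoc _ _ _ ⟩
    Θ full + (- sum (λ k → Θ (omit (suc k))) - Θ (omit zero))
      ≈⟨ +-congˡ (trans (-‿+-comm _ _) (-‿cong (+-comm _ _))) ⟩
    Θ full - (Θ (omit zero) + sum (λ k → Θ (omit (suc k)))) ∎

  -- The cancellation takes place between permutations for a fixed mask, so the sum over masks has
  -- to be outermost.
  alternatingSum-inclusionExclusion : ∀ k (Θ : Permutation′ n → Vec Bool k → Carrier) →
    alternatingSum (λ σ → inclusionExclusion k (Θ σ)) ≈
    inclusionExclusion k (λ m → alternatingSum (λ σ → Θ σ m))
  alternatingSum-inclusionExclusion {n} zero    Θ = refl
  alternatingSum-inclusionExclusion {n} (suc k) Θ = trans (alternatingSum-sub {n} _ _) (sub-cong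
    (alternatingSum-inclusionExclusion k (λ σ m → Θ σ (true ∷ m)))
    (alternatingSum-inclusionExclusion k (λ σ m → Θ σ (false ∷ m))))

  -- Cancellation of the terms with two omitted indices

  module _ (div : DivisionByIntegers K) where

    ×-injective : ∀ k .{{_ : ℕ.NonZero k}} {x y} → k ×ᴷ x ≈ k ×ᴷ y → x ≈ y
    ×-injective k = proj₁ (div (+ k))

    x≈-x⇒x≈0 : ∀ {x} → x ≈ - x → x ≈ 0#
    x≈-x⇒x≈0 {x} x≈-x = ×-injective 2 (begin
      x + (x + 0#)    ≈⟨ +-cong x≈-x (+-identityʳ x) ⟩
      - x + x         ≈⟨ -‿inverseˡ x ⟩
      0#              ≈⟨ trans (+-congˡ (+-identityʳ 0#)) (+-identityʳ 0#) ⟨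
      0# + (0# + 0#)  ∎)

    -- A term of the polarization omitting both i and j does not change when σ
    -- is precomposed with the transposition of i and j.
    alternatingSum-polarization : (A : Matrix K n) {f : Carrier → Carrier} → Congruent f →
      alternatingSum (λ σ → topLayers f (diagonal A σ)) ≈
      alternatingSum (λ σ → Δ* (diagonal A σ) f 0#)
    alternatingSum-polarization {n} A {f} f-cong = sym (begin
      alternatingSum (λ σ → Δ* (diagonal A σ) f 0#)
        ≈⟨ alternatingSum-cong {n} (λ σ → trans (polarization (diagonal A σ) f-cong 0#)
             (inclusionExclusion-cong n (λ m → f-cong (+-identityˡ _)))) ⟩
      alternatingSum (λ σ → inclusionExclusion n (λ m → f (masked m (diagonal A σ))))
        ≈⟨ alternatingSum-inclusionExclusion n (λ σ m → term m σ) ⟩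
      inclusionExclusion n (λ m → alternatingSum (term m))
        ≈⟨ inclusionExclusion-topLayers n _ cancels ⟩
      alternatingSum (term full) - sum (λ k → alternatingSum (term (omit k)))
        ≈⟨ +-congˡ (-‿cong (alternatingSum-sum n (λ k → term (omit k)))) ⟨
      alternatingSum (term full) - alternatingSum (λ σ → sum (λ k → term (omit k) σ))
        ≈⟨ alternatingSum-sub {n} _ _ ⟨
      alternatingSum (λ σ → term full σ - sum (λ k → term (omit k) σ))
        ≈⟨ alternatingSum-cong {n} (λ σ → sub-cong
             (f-cong (masked-full (diagonal A σ)))
             (sum-cong-≋ {n} (λ k → f-cong (masked-omit (diagonal A σ) k)))) ⟩
      alternatingSum (λ σ → topLayers f (diagonal A σ)) ∎)
      where
      term : Vec Bool n → Permutation′ n → Carrier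
      term m σ = f (masked m (diagonal A σ))

      alternatingSum-sum : ∀ k (g : Fin k → Permutation′ n → Carrier) →
        alternatingSum (λ σ → sum (λ i → g i σ)) ≈ sum (λ i → alternatingSum (g i))
      -- An alternating sum of zeros is its own double, hence zero.
      alternatingSum-sum zero    g = x+x≈x⇒x≈0 _ (trans (sym (alternatingSum-+ {n} _ _))
        (alternatingSum-cong {n} (λ _ → +-identityʳ 0#)))
      alternatingSum-sum (suc k) g = trans (alternatingSum-+ {n} (g zero) _)
        (+-congˡ (alternatingSum-sum k (g ∘ suc)))

      cancels : ∀ m i j → i ≢ j → lookup m i ≡ false → lookup m j ≡ false →
                alternatingSum (term m) ≈ 0#
      cancels m i j i≢j i∉m j∉m = x≈-x⇒x≈0 (trans
        (alternatingSum-cong {n} (λ σ → f-cong (masked-cong m (λ k k∈m → reflexive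
          (cong (λ l → A k (σ ⟨$⟩ʳ l)) (≡.sym (transpose-fix i j k
            (λ k≡i → true≢false (≡.trans (≡.sym k∈m) (≡.trans (cong (lookup m) k≡i) i∉m)))
            (λ k≡j → true≢false (≡.trans (≡.sym k∈m) (≡.trans (cong (lookup m) k≡j) j∉m))))))))))
        (alternatingSum-transpose i≢j (term m)
          (λ {σ} {τ} σ≈τ → f-cong (masked-cong m (λ k _ → diagonal-cong A {σ} {τ} σ≈τ k)))))
        where
        true≢false : true ≢ false
        true≢false ()

    -- Additivity, antisymmetry and invariance under transposition of the matrix

    module _ {m : ℕ} where

      private
        n′ = suc m
        det = edet K div {m}
        power : Carrier → Carrier
        power x = _^1+_ K x m

        Q : Matrix K n′ → Carrier
        Q A = alternatingSum (λ σ → topLayers power (diagonal A σ))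

        power-cong′ : Congruent power
        power-cong′ = power-cong m

        -- Identities for `det` are proved for its n!-fold multiple, an alternating sum free of
        -- division, and then descend.
        !-injective : ∀ {x y} → (n′ !) ×ᴷ x ≈ (n′ !) ×ᴷ y → x ≈ y
        !-injective = ×-injective (n′ !) {{ℕ._!≢0 n′}}

        Q-cong : {A B : Matrix K n′} → (∀ i j → A i j ≈ B i j) → Q A ≈ Q B
        Q-cong A≈B = alternatingSum-cong {n′} (λ σ → topLayers-cong power-cong′ (λ i → A≈B i (σ ⟨$⟩ʳ i)))

      edet-cong : {A B : Matrix K n′} → (∀ i j → A i j ≈ B i j) → det A ≈ det B
      edet-cong {A} {B} A≈B = !-injective (trans (!·edet div m A) (trans (Q-cong A≈B) (sym (!·edet div m B))))

      edet-transpose : (A : Matrix K n′) → det A ≈ det (transpose A)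
      edet-transpose A = !-injective (begin
        (n′ !) ×ᴷ det A
          ≈⟨ !·edet div m A ⟩
        alternatingSum (λ σ → topLayers power (diagonal A σ))
          ≈⟨ alternatingSum-flip (λ σ → topLayers power (diagonal A σ)) (λ {σ} {τ} σ≈τ →
               topLayers-cong power-cong′ (diagonal-cong A {σ} {τ} σ≈τ)) ⟩
        alternatingSum (λ σ → topLayers power (λ i → A i (σ ⟨$⟩ˡ i)))
          -- `topLayers` is symmetric, so the entries may be listed by column instead of by row.
          ≈⟨ alternatingSum-cong {n′} (λ σ → trans
               (sym (topLayers-permute power-cong′ σ (λ i → A i (σ ⟨$⟩ˡ i))))
               (topLayers-cong power-cong′ (λ i → reflexive (cong (A (σ ⟨$⟩ʳ i)) (inverseˡ σ {i}))))) ⟩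
        alternatingSum (λ σ → topLayers power (diagonal (transpose A) σ))
          ≈⟨ !·edet div m (transpose A) ⟨
        (n′ !) ×ᴷ det (transpose A) ∎)

      edet-swapRows : (A : Matrix K n′) (i j : Fin n′) → i ≢ j → det (swapRows K i j A) ≈ - det A
      edet-swapRows A i j i≢j = !-injective (begin
        (n′ !) ×ᴷ det (swapRows K i j A)
          ≈⟨ !·edet div m (swapRows K i j A) ⟩
        alternatingSum (λ σ → topLayers power (λ k → A (ρ ⟨$⟩ʳ k) (σ ⟨$⟩ʳ k)))
          -- Listing the entries in the order given by the involution `ρ` moves `ρ` from the row
          -- index to the column index.
          ≈⟨ alternatingSum-cong {n′} (λ σ → trans
               (sym (topLayers-permute power-cong′ ρ (λ k → A (ρ ⟨$⟩ʳ k) (σ ⟨$⟩ʳ k))))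
               (topLayers-cong power-cong′ (λ k → reflexive
                 (cong (λ l → A l (σ ⟨$⟩ʳ (ρ ⟨$⟩ʳ k))) (transpose-involutive i j k))))) ⟩
        alternatingSum (λ σ → topLayers power (diagonal A (ρ ∘ₚ σ)))
          ≈⟨ alternatingSum-transpose i≢j (λ σ → topLayers power (diagonal A σ)) (λ {σ} {τ} σ≈τ →
               topLayers-cong power-cong′ (diagonal-cong A {σ} {τ} σ≈τ)) ⟩
        - Q A
          ≈⟨ -‿cong (!·edet div m A) ⟨
        - ((n′ !) ×ᴷ det A)
          ≈⟨ ×-neg (n′ !) (det A) ⟨
        (n′ !) ×ᴷ (- det A) ∎)
        where ρ = Perm.transpose i j

      -- Replacing a row replaces a single entry of each diagonal. For a single permutation
      -- `topLayers` is in general not additive in that entry; the full polarization is.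
      edet-setRow-+ : (A : Matrix K n′) (i : Fin n′) (u v : Vector Carrier n′) →
        det (setRow K A i (λ j → u j + v j)) ≈ det (setRow K A i u) + det (setRow K A i v)
      edet-setRow-+ A i u v = !-injective (begin
        (n′ !) ×ᴷ det (setRow K A i (λ j → u j + v j))
          ≈⟨ !·edet-setRow (λ j → u j + v j) ⟩
        alternatingSum (λ σ → Δ* (updateAt (diagonal A σ) i (const (u (σ ⟨$⟩ʳ i) + v (σ ⟨$⟩ʳ i)))) power 0#)
          ≈⟨ alternatingSum-cong {n′} (λ σ →
               Δ*-additive (diagonal A σ) i (u (σ ⟨$⟩ʳ i)) (v (σ ⟨$⟩ʳ i)) power-cong′ (degree-power m) 0#) ⟩
        alternatingSum (λ σ →
          Δ* (updateAt (diagonal A σ) i (const (u (σ ⟨$⟩ʳ i)))) power 0# +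
          Δ* (updateAt (diagonal A σ) i (const (v (σ ⟨$⟩ʳ i)))) power 0#)
          ≈⟨ alternatingSum-+ {n′} _ _ ⟩
        _ + _
          ≈⟨ +-cong (!·edet-setRow u) (!·edet-setRow v) ⟨
        (n′ !) ×ᴷ det (setRow K A i u) + (n′ !) ×ᴷ det (setRow K A i v)
          ≈⟨ ×-distrib-+ _ _ (n′ !) ⟨
        (n′ !) ×ᴷ (det (setRow K A i u) + det (setRow K A i v)) ∎)
        where
        diagonal-setRow : ∀ w σ k → diagonal (setRow K A i w) σ k ≡
                          updateAt (diagonal A σ) i (const (w (σ ⟨$⟩ʳ i))) k
        diagonal-setRow w σ k with k Fin.≟ i
        ... | yes ≡.refl = ≡.trans (cong (λ r → r (σ ⟨$⟩ʳ k)) (Vector.updateAt-updates k A))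
                                   (≡.sym (Vector.updateAt-updates k (diagonal A σ)))
        ... | no  k≢i = ≡.trans (cong (λ r → r (σ ⟨$⟩ʳ k)) (Vector.updateAt-minimal k i A k≢i))
                                (≡.sym (Vector.updateAt-minimal k i (diagonal A σ) k≢i))

        !·edet-setRow : ∀ w → (n′ !) ×ᴷ det (setRow K A i w) ≈
          alternatingSum (λ σ → Δ* (updateAt (diagonal A σ) i (const (w (σ ⟨$⟩ʳ i)))) power 0#)
        !·edet-setRow w = trans (!·edet div m (setRow K A i w))
          (trans (alternatingSum-polarization (setRow K A i w) power-cong′)
                 (alternatingSum-cong {n′} (λ σ →
                   Δ*-cong (λ k → reflexive (diagonal-setRow w σ k)) power-cong′ 0#)))

      -- A zero row is its own double, so additivity gives `det A + det A ≈ det A`.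
      edet-zeroRow : (A : Matrix K n′) (i : Fin n′) → (∀ j → A i j ≈ 0#) → det A ≈ 0#
      edet-zeroRow A i Aᵢ≈0 = x+x≈x⇒x≈0 (det A) (begin
        det A + det A
          ≈⟨ +-cong (edet-cong unchanged) (edet-cong unchanged) ⟩
        det (setRow K A i (A i)) + det (setRow K A i (A i))
          ≈⟨ edet-setRow-+ A i (A i) (A i) ⟨
        det (setRow K A i (λ j → A i j + A i j))
          ≈⟨ edet-cong doubled ⟩
        det A ∎)
        where
        unchanged : ∀ k l → A k l ≈ setRow K A i (A i) k l
        unchanged k l = reflexive (cong (λ r → r l) (≡.sym (Vector.updateAt-id-local i A ≡.refl k)))

        doubled : ∀ k l → setRow K A i (λ j → A i j + A i j) k l ≈ A k l
        doubled k l with k Fin.≟ i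
        ... | yes ≡.refl = trans (reflexive (cong (λ r → r l) (Vector.updateAt-updates k A)))
          (trans (+-cong (Aᵢ≈0 l) refl) (+-identityˡ _))
        ... | no  k≢i = reflexive (cong (λ r → r l) (Vector.updateAt-minimal k i A k≢i))

      edet-equalRows : (A : Matrix K n′) (i j : Fin n′) → i ≢ j → (∀ k → A i k ≈ A j k) → det A ≈ 0#
      edet-equalRows A i j i≢j Aᵢ≈Aⱼ = x≈-x⇒x≈0 (trans
        (edet-cong (λ k → unchanged k (k Fin.≟ i) (k Fin.≟ j)))
        (edet-swapRows A i j i≢j))
        where
        unchanged : ∀ k → Dec (k ≡ i) → Dec (k ≡ j) → ∀ l → A k l ≈ swapRows K i j A k l
        unchanged k (yes ≡.refl) _ l =
          trans (Aᵢ≈Aⱼ l) (reflexive (cong (λ r → A r l) (≡.sym (transpose-fst i j))))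
        unchanged k (no _) (yes ≡.refl) l =
          trans (sym (Aᵢ≈Aⱼ l)) (reflexive (cong (λ r → A r l) (≡.sym (transpose-snd i j))))
        unchanged k (no k≢i) (no k≢j) l =
          reflexive (cong (λ r → A r l) (≡.sym (transpose-fix i j k k≢i k≢j)))

      edet-setColumn-+ : (A : Matrix K n′) (j : Fin n′) (u v : Vector Carrier n′) →
        det (setColumn K A j (λ i → u i + v i)) ≈ det (setColumn K A j u) + det (setColumn K A j v)
      edet-setColumn-+ A j u v = begin
        det (setColumn K A j (λ i → u i + v i))         ≈⟨ transposed (λ i → u i + v i) ⟩
        det (setRow K Aᵀ j (λ i → u i + v i))           ≈⟨ edet-setRow-+ Aᵀ j u v ⟩
        det (setRow K Aᵀ j u) + det (setRow K Aᵀ j v)   ≈⟨ +-cong (transposed u) (transposed v) ⟨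
        det (setColumn K A j u) + det (setColumn K A j v)∎
        where
        Aᵀ = transpose A

        transpose-setColumn : ∀ w k l → setColumn K A j w l k ≡ setRow K Aᵀ j w k l
        transpose-setColumn w k l with k Fin.≟ j
        ... | yes ≡.refl = ≡.trans (Vector.updateAt-updates k (A l))
          (cong (λ r → r l) (≡.sym (Vector.updateAt-updates k Aᵀ)))
        ... | no  k≢j = ≡.trans (Vector.updateAt-minimal k j (A l) k≢j)
          (cong (λ r → r l) (≡.sym (Vector.updateAt-minimal k j Aᵀ k≢j)))

        transposed : ∀ w → det (setColumn K A j w) ≈ det (setRow K Aᵀ j w)
        transposed w = trans (edet-transpose (setColumn K A j w))
          (edet-cong (λ k l → reflexive (transpose-setColumn w k l)))

      edet-swapColumns : (A : Matrix K n′) (i j : Fin n′) → i ≢ j → det (swapColumns K i j A) ≈ - det A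
      edet-swapColumns A i j i≢j = begin
        det (swapColumns K i j A)           ≈⟨ edet-transpose (swapColumns K i j A) ⟩
        det (swapRows K i j (transpose A))  ≈⟨ edet-swapRows (transpose A) i j i≢j ⟩
        - det (transpose A)                 ≈⟨ -‿cong (edet-transpose A) ⟨
        - det A                             ∎

      edet-zeroColumn : (A : Matrix K n′) (j : Fin n′) → (∀ i → A i j ≈ 0#) → det A ≈ 0#
      edet-zeroColumn A j A≈0 = trans (edet-transpose A) (edet-zeroRow (transpose A) j A≈0)

      edet-equalColumns : (A : Matrix K n′) (i j : Fin n′) → i ≢ j → (∀ k → A k i ≈ A k j) → det A ≈ 0#
      edet-equalColumns A i j i≢j Aᵢ≈Aⱼ =
        trans (edet-transpose A) (edet-equalRows (transpose A) i j i≢j Aᵢ≈Aⱼ)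

-- Rational upper triangular matrices

module _ (c ℓ : Level) where

  open ℚ using (ℚᵘ; mkℚᵘ; *≡*; 0ℚᵘ; 1ℚᵘ; _≃_; 1/_; _+_; _*_; -_)

  -- The upper triangular matrix with rows (p , q) and (0 , r).
  record UpperTriangular : Set c where
    constructor ⟦_,_,_⟧
    field
      p q r : ℚᵘ

  open UpperTriangular

  -- A record may be declared at any level, so the counterexample inhabits the arbitrary levels `c`
  -- and `ℓ` of the theorem without lifting.
  record _≋_ (x y : UpperTriangular) : Set ℓ where
    constructor eq
    field
      p≃ : p x ≃ p y
      q≃ : q x ≃ q y
      r≃ : r x ≃ r y

  open +-*-Solver using (solve; _:+_; _:*_; _:=_)

  upperTriangular : RingWithoutOne c ℓ
  upperTriangular = record
    { Carrier = UpperTriangular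
    ; _≈_     = _≋_
    ; _+_     = λ x y → ⟦ p x + p y , q x + q y , r x + r y ⟧
    ; _*_     = λ x y → ⟦ p x * p y , p x * q y + q x * r y , r x * r y ⟧
    ; -_      = λ x → ⟦ - p x , - q x , - r x ⟧
    ; 0#      = ⟦ 0ℚᵘ , 0ℚᵘ , 0ℚᵘ ⟧
    ; isRingWithoutOne = record
      { +-isAbelianGroup = record
        { isGroup = record
          { isMonoid = record
            { isSemigroup = record
              { isMagma = record
                { isEquivalence = record
                  { refl  = eq ℚₚ.≃-refl ℚₚ.≃-refl ℚₚ.≃-refl
                  ; sym   = λ (eq a b d) → eq (ℚₚ.≃-sym a) (ℚₚ.≃-sym b) (ℚₚ.≃-sym d)
                  ; trans = λ (eq a b d) (eq a′ b′ d′) →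
                      eq (ℚₚ.≃-trans a a′) (ℚₚ.≃-trans b b′) (ℚₚ.≃-trans d d′)
                  }
                ; ∙-cong = λ (eq a b d) (eq a′ b′ d′) →
                    eq (ℚₚ.+-cong a a′) (ℚₚ.+-cong b b′) (ℚₚ.+-cong d d′)
                }
              ; assoc = λ x y z → eq
                  (ℚₚ.+-assoc (p x) (p y) (p z)) (ℚₚ.+-assoc (q x) (q y) (q z)) (ℚₚ.+-assoc (r x) (r y) (r z))
              }
            ; identity = (λ x → eq (ℚₚ.+-identityˡ (p x)) (ℚₚ.+-identityˡ (q x)) (ℚₚ.+-identityˡ (r x)))
                       , (λ x → eq (ℚₚ.+-identityʳ (p x)) (ℚₚ.+-identityʳ (q x)) (ℚₚ.+-identityʳ (r x)))
            }
          ; inverse = (λ x → eq (ℚₚ.+-inverseˡ (p x)) (ℚₚ.+-inverseˡ (q x)) (ℚₚ.+-inverseˡ (r x)))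
                    , (λ x → eq (ℚₚ.+-inverseʳ (p x)) (ℚₚ.+-inverseʳ (q x)) (ℚₚ.+-inverseʳ (r x)))
          ; ⁻¹-cong = λ (eq a b d) → eq (ℚₚ.-‿cong a) (ℚₚ.-‿cong b) (ℚₚ.-‿cong d)
          }
        ; comm = λ x y → eq (ℚₚ.+-comm (p x) (p y)) (ℚₚ.+-comm (q x) (q y)) (ℚₚ.+-comm (r x) (r y))
        }
      ; *-cong = λ (eq a b d) (eq a′ b′ d′) →
          eq (ℚₚ.*-cong a a′) (ℚₚ.+-cong (ℚₚ.*-cong a b′) (ℚₚ.*-cong b d′)) (ℚₚ.*-cong d d′)
      ; *-assoc = λ x y z → eq
          (ℚₚ.*-assoc (p x) (p y) (p z))
          (solve 7 (λ px qx py qy ry qz rz → px :* py :* qz :+ (px :* qy :+ qx :* ry) :* rz :=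
                                             px :* (py :* qz :+ qy :* rz) :+ qx :* (ry :* rz))
             ℚₚ.≃-refl (p x) (q x) (p y) (q y) (r y) (q z) (r z))
          (ℚₚ.*-assoc (r x) (r y) (r z))
      ; distrib =
          (λ x y z → eq
            (ℚₚ.*-distribˡ-+ (p x) (p y) (p z))
            (solve 6 (λ px qx qy ry qz rz → px :* (qy :+ qz) :+ qx :* (ry :+ rz) :=
                                            (px :* qy :+ qx :* ry) :+ (px :* qz :+ qx :* rz))
               ℚₚ.≃-refl (p x) (q x) (q y) (r y) (q z) (r z))
            (ℚₚ.*-distribˡ-+ (r x) (r y) (r z)))
        , (λ x y z → eq
            (ℚₚ.*-distribʳ-+ (p x) (p y) (p z))
            (solve 6 (λ qx rx py qy pz qz → (py :+ pz) :* qx :+ (qy :+ qz) :* rx :=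
                                            (py :* qx :+ qy :* rx) :+ (pz :* qx :+ qz :* rx))
               ℚₚ.≃-refl (q x) (r x) (p y) (q y) (p z) (q z))
            (ℚₚ.*-distribʳ-+ (r x) (r y) (r z)))
      }
    }

  open RingWithoutOne upperTriangular using (_≈_; refl; sym; trans; +-cong; -‿cong)
  open RawMonoid (AbelianGroup.rawMonoid (RingWithoutOne.+-abelianGroup upperTriangular))
    using () renaming (_×_ to _×ᴷ_)

  scale : ℚᵘ → UpperTriangular → UpperTriangular
  scale s x = ⟦ s * p x , s * q x , s * r x ⟧

  scale-cong : ∀ s {x y} → x ≈ y → scale s x ≈ scale s y
  scale-cong s (eq a b d) = eq (ℚₚ.*-congˡ {s} a) (ℚₚ.*-congˡ {s} b) (ℚₚ.*-congˡ {s} d)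

  scale-inverse : ∀ s t → s * t ≃ 1ℚᵘ → ∀ x → scale s (scale t x) ≈ x
  scale-inverse s t st≃1 x = eq (cancel (p x)) (cancel (q x)) (cancel (r x))
    where
    cancel : ∀ u → s * (t * u) ≃ u
    cancel u = ℚₚ.≃-trans (ℚₚ.≃-sym (ℚₚ.*-assoc s t u)) (ℚₚ.≃-trans (ℚₚ.*-congʳ st≃1) (ℚₚ.*-identityˡ u))

  -- The second argument of `mkℚᵘ` is the denominator minus one.
  fromℤ : ℤ → ℚᵘ
  fromℤ z = mkℚᵘ z 0

  ×-scale : ∀ k x → k ×ᴷ x ≈ scale (fromℤ (+ k)) x
  ×-scale zero    x = eq (zeroˡ (p x)) (zeroˡ (q x)) (zeroˡ (r x))
    where
    zeroˡ : ∀ u → 0ℚᵘ ≃ 0ℚᵘ * u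
    zeroˡ u = ℚₚ.≃-sym (ℚₚ.*-zeroˡ u)
  ×-scale (suc k) x = trans (+-cong {x} refl (×-scale k x)) (eq (step (p x)) (step (q x)) (step (r x)))
    where
    1+k : 1ℚᵘ + fromℤ (+ k) ≃ fromℤ (+ suc k)
    1+k = *≡* (cong (ℤ._* + 1) (cong (ℤ._+_ (+ 1)) (ℤ.*-identityʳ (+ k))))

    step : ∀ u → u + fromℤ (+ k) * u ≃ fromℤ (+ suc k) * u
    step u = ℚₚ.≃-trans (ℚₚ.+-congˡ (fromℤ (+ k) * u) (ℚₚ.≃-sym (ℚₚ.*-identityˡ u)))
      (ℚₚ.≃-trans (ℚₚ.≃-sym (ℚₚ.*-distribʳ-+ u 1ℚᵘ (fromℤ (+ k)))) (ℚₚ.*-congʳ {u} 1+k))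

  ·-scale : ∀ z x → _·_ upperTriangular z x ≈ scale (fromℤ z) x
  ·-scale (+ k)    x = ×-scale k x
  ·-scale -[1+ k ] x = trans (-‿cong (×-scale (suc k) x)) (eq (negate (p x)) (negate (q x)) (negate (r x)))
    where
    negate : ∀ u → - (fromℤ (+ suc k) * u) ≃ fromℤ -[1+ k ] * u
    negate = ℚₚ.neg-distribˡ-* (fromℤ (+ suc k))

  upperTriangular-division : DivisionByIntegers upperTriangular
  upperTriangular-division z =
      (λ {x} {y} zx≈zy → trans (sym (scale-inverse (1/ s) s (ℚₚ.*-inverseˡ s) x))
        (trans (scale-cong (1/ s) (trans (sym (·-scale z x)) (trans zx≈zy (·-scale z y))))
               (scale-inverse (1/ s) s (ℚₚ.*-inverseˡ s) y)))
    , (λ y → scale (1/ s) y , λ {x} x≈ → trans (·-scale z x)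
        (trans (scale-cong s x≈) (scale-inverse s (1/ s) (ℚₚ.*-inverseʳ s) y)))
    where s = fromℤ z

  -- Counterexamples to expansion and multiplicativity

  diag : UpperTriangular → UpperTriangular → Matrix upperTriangular 2
  diag x y zero       zero       = x
  diag x y (suc zero) (suc zero) = y
  diag x y _          _          = ⟦ 0ℚᵘ , 0ℚᵘ , 0ℚᵘ ⟧

  e₁₁ e₁₂ e₂₂ : UpperTriangular
  e₁₁ = ⟦ 1ℚᵘ , 0ℚᵘ , 0ℚᵘ ⟧
  e₁₂ = ⟦ 0ℚᵘ , 1ℚᵘ , 0ℚᵘ ⟧
  e₂₂ = ⟦ 0ℚᵘ , 0ℚᵘ , 1ℚᵘ ⟧

  edet₂ : Matrix upperTriangular 2 → UpperTriangular
  edet₂ = edet upperTriangular upperTriangular-division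

  -- The expansion has the single nonzero term `e₁₁ * e₁₂`, which is `e₁₂`. Since `e₁₂ * e₁₁`
  -- vanishes, the average of the two orders is only half of it. The upper right coordinates are
  -- closed rationals, so evaluation exposes the contradiction.
  ¬rowExpansion : ¬ RowExpansion upperTriangular upperTriangular-division (diag e₁₁ e₁₂) zero
  ¬rowExpansion (eq _ (*≡* ()) _)

  ¬columnExpansion : ¬ ColumnExpansion upperTriangular upperTriangular-division (diag e₁₁ e₁₂) zero
  ¬columnExpansion (eq _ (*≡* ()) _)

  -- With A = diag (e₁₁ , e₁₂) and B = diag (e₁₁ , e₂₂): edet (AB) = e₁₂ / 2,
  -- while e₁₁ and e₂₂ annihilate each other, so edet B = 0.
  ¬multiplicative : ¬ (edet₂ (_⊗_ upperTriangular (diag e₁₁ e₁₂) (diag e₁₁ e₂₂)) ≈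
    RingWithoutOne._*_ upperTriangular (edet₂ (diag e₁₁ e₁₂)) (edet₂ (diag e₁₁ e₂₂)))
  ¬multiplicative (eq _ (*≡* ()) _)

lemma1 : ∀ {c ℓ} →
  ((K : RingWithoutOne c ℓ) (div : DivisionByIntegers K) (m : ℕ) →
    let open RingWithoutOne K
        n = suc m
        det = edet K div {m}
    in
    (((A : Matrix K n) (i : Fin n) (u v : Vector Carrier n) →
        det (setRow K A i (λ j → u j + v j)) ≈ det (setRow K A i u) + det (setRow K A i v))
     × ((A : Matrix K n) (j : Fin n) (u v : Vector Carrier n) →
        det (setColumn K A j (λ i → u i + v i)) ≈ det (setColumn K A j u) + det (setColumn K A j v)))
    × (((A : Matrix K n) (i j : Fin n) → i ≢ j → det (swapRows K i j A) ≈ - det A)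
     × ((A : Matrix K n) (i j : Fin n) → i ≢ j → det (swapColumns K i j A) ≈ - det A))
    × (((A : Matrix K n) (i : Fin n) → (∀ j → A i j ≈ 0#) → det A ≈ 0#)
     × ((A : Matrix K n) (j : Fin n) → (∀ i → A i j ≈ 0#) → det A ≈ 0#))
    × (((A : Matrix K n) (i j : Fin n) → i ≢ j → (∀ k → A i k ≈ A j k) → det A ≈ 0#)
     × ((A : Matrix K n) (i j : Fin n) → i ≢ j → (∀ k → A k i ≈ A k j) → det A ≈ 0#))
    × ((A : Matrix K n) → det A ≈ det (transpose A)))
  × ¬ ((K : RingWithoutOne c ℓ) (div : DivisionByIntegers K) (m : ℕ)
       (A : Matrix K (suc (suc m))) (i : Fin (suc (suc m))) → RowExpansion K div A i)
  × ¬ ((K : RingWithoutOne c ℓ) (div : DivisionByIntegers K) (m : ℕ)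
       (A : Matrix K (suc (suc m))) (j : Fin (suc (suc m))) → ColumnExpansion K div A j)
  × ¬ ((K : RingWithoutOne c ℓ) (div : DivisionByIntegers K) (m : ℕ)
       (A B : Matrix K (suc m)) →
       let open RingWithoutOne K in
       edet K div (_⊗_ K A B) ≈ edet K div A * edet K div B)
lemma1 {c} {ℓ} =
    (λ K div m →
        (edet-setRow-+ K div , edet-setColumn-+ K div)
      , (edet-swapRows K div , edet-swapColumns K div)
      , (edet-zeroRow K div , edet-zeroColumn K div)
      , (edet-equalRows K div , edet-equalColumns K div)
      , edet-transpose K div)
  , (λ expansion → ¬rowExpansion c ℓ
      (expansion (upperTriangular c ℓ) (upperTriangular-division c ℓ) 0 (diag c ℓ (e₁₁ c ℓ) (e₁₂ c ℓ)) zero))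
  , (λ expansion → ¬columnExpansion c ℓ
      (expansion (upperTriangular c ℓ) (upperTriangular-division c ℓ) 0 (diag c ℓ (e₁₁ c ℓ) (e₁₂ c ℓ)) zero))
  , (λ multiplicative → ¬multiplicative c ℓ
      (multiplicative (upperTriangular c ℓ) (upperTriangular-division c ℓ) 1
        (diag c ℓ (e₁₁ c ℓ) (e₁₂ c ℓ)) (diag c ℓ (e₁₁ c ℓ) (e₂₂ c ℓ))))
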